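{- Let $G$ be a $2$-connected multigraph. Then the following are equivalent: (1) $G$ satisfies $(\spadesuit)_2$; (2) either $G$ is the $2$-cycle $C_2$, or $G$ can be obtained from cliques $K_4$ by repeated applications of Construction A with $\delta=2$ (i.e. $G$ belongs to the smallest class of multigraphs containing $K_4$ and closed under Construction A with $\delta=2$).
   Context: Multigraphs are finite, undirected, loop-free, and may have parallel edges. $C_2$ is the multigraph with two vertices and two parallel edges between them; $K_4$ is the complete simple graph on four vertices. For a multigraph $G=(V,E)$ and $S\subseteq V$, $E(S)$ denotes the set of edges with both endpoints in $S$, $G|_S$ the induced sub-multigraph on $S$, and $G/E(S)$ the result of contracting $E(S)$. A good flat of a $2$-connected multigraph $G=(V,E)$ is a subset $S\subsetneq V$ such that both $G|_S$ and $G/E(S)$ are $2$-connected. For an integer $\delta\ge 2$ and a $2$-connected multigraph $G=(V,E)$, the weight function $w\colon E\to\{1,\delta-1\}$ is given by $w(e)=1$ if $G\setminus e$ is $2$-connected and $w(e)=\delta-1$ if $G/e$ is $2$-connected; $w(F)=\sum_{e\in F}w(e)$. $G$ satisfies $(\spadesuit)_\delta$ if it possesses such a weight function and (1) $w(E)=\delta(|V|-1)$ and (2) $w(E(S))+1=\delta(|S|-1)$ for every good flat $S$. (For $\delta=2$ all weights equal $1$.) Construction A (parameter $\delta$): given $2$-connected multigraphs $G_1,G_2$ and edges $e_1$ of $G_1$ with $w(e_1)=1$ and $e_2$ of $G_2$ with $w(e_2)=\delta-1$, take the disjoint union, identify the endpoints of $e_1$ with those of $e_2$ (so that $e_1,e_2$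 become one glued edge), and delete the glued edge. -}

module Defs where

open import Data.Nat using (ℕ; zero; suc; _+_; _*_; _∸_; _≤_)
open import Data.Fin using (Fin; zero; suc; _≟_)
open import Data.Bool using (Bool; true; false; not; _∧_; T; if_then_else_)
open import Data.Unit using (⊤; tt)
open import Data.Product using (Σ; Σ-syntax; ∃; ∃-syntax; _×_; _,_; proj₁; proj₂)
open import Data.Sum using (_⊎_; inj₁; inj₂)
open import Function using (_∘_)
open import Function.Bundles using (_↔_; Inverse)
open import Relation.Nullary using (¬_; does)
open import Relation.Binary.PropositionalEquality using (_≡_; _≢_)
open import Relation.Binary.Construct.Closure.ReflexiveTransitive using (Star)

-- Unordered equality of endpoint pairs (edges are undirected)

UEq : {A : Set} → A × A → A × A → Set
UEq (a , b) (c , d) = ((a ≡ c) × (b ≡ d)) ⊎ ((a ≡ d) × (b ≡ c))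

mapPair : {A B : Set} → (A → B) → A × A → B × B
mapPair f (a , b) = f a , f b

record Gr : Set₁ where
  field
    V    : Set
    E    : Set
    ends : E → V × V

open Gr public

Adj : (H : Gr) → (V H → Set) → V H → V H → Set
Adj H P x y = P x × P y × Σ[ e ∈ E H ] UEq (ends H e) (x , y)

ConnectedOn : (H : Gr) → (V H → Set) → Set
ConnectedOn H P = ∀ x y → P x → P y → Star (Adj H P) x y

TwoConn : Gr → Set
TwoConn H =
  (∀ e → proj₁ (ends H e) ≢ proj₂ (ends H e)) ×
  (Σ[ x ∈ V H ] Σ[ y ∈ V H ] x ≢ y) ×
  ConnectedOn H (λ _ → ⊤) ×
  (∀ v → ConnectedOn H (λ x → x ≢ v))

record MGraph : Set where
  field
    n    : ℕ
    m    : ℕ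
    ends : Fin m → Fin n × Fin n

open MGraph public renaming (ends to endsG)

toGr : MGraph → Gr
toGr G = record { V = Fin (n G) ; E = Fin (m G) ; ends = endsG G }

LoopFree : MGraph → Set
LoopFree G = ∀ e → proj₁ (endsG G e) ≢ proj₂ (endsG G e)

Subset : ℕ → Set
Subset k = Fin k → Bool

sumF : ∀ {k} → (Fin k → ℕ) → ℕ
sumF {zero}  f = 0
sumF {suc k} f = f zero + sumF (f ∘ suc)

size : ∀ {k} → Subset k → ℕ
size S = sumF (λ x → if S x then 1 else 0)

inE : (G : MGraph) → Subset (n G) → Fin (m G) → Bool
inE G S e = S (proj₁ (endsG G e)) ∧ S (proj₂ (endsG G e))

induced : (G : MGraph) → Subset (n G) → Gr
induced G S = record
  { V = Σ[ x ∈ Fin (n G) ] T (S x)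
  ; E = Σ[ e ∈ Fin (m G) ] (T (S (proj₁ (endsG G e))) × T (S (proj₂ (endsG G e))))
  ; ends = λ { (e , p , q) → (proj₁ (endsG G e) , p) , (proj₂ (endsG G e) , q) }
  }

-- quotient: identify all vertices of S into one new vertex (tt),
-- keeping exactly the edges selected by `keep` (endpoints mapped)
QV : (G : MGraph) → Subset (n G) → Set
QV G S = (Σ[ x ∈ Fin (n G) ] T (not (S x))) ⊎ ⊤

private
  go : {X : Set} (b : Bool) → (T (not b) → X) → X ⊎ ⊤
  go true  k = inj₂ tt
  go false k = inj₁ (k tt)

qmap : (G : MGraph) (S : Subset (n G)) → Fin (n G) → QV G S
qmap G S x = go (S x) (λ p → x , p)

quot : (G : MGraph) → Subset (n G) → (Fin (m G) → Bool) → Gr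
quot G S keep = record
  { V = QV G S
  ; E = Σ[ e ∈ Fin (m G) ] T (keep e)
  ; ends = λ { (e , _) → mapPair (qmap G S) (endsG G e) }
  }

contractSet : (G : MGraph) → Subset (n G) → Gr
contractSet G S = quot G S (λ e → not (inE G S e))

delete : (G : MGraph) → Fin (m G) → Gr
delete G e = record
  { V = Fin (n G)
  ; E = Σ[ f ∈ Fin (m G) ] T (not (does (f ≟ e)))
  ; ends = λ { (f , _) → endsG G f }
  }

-- G / e : identify the two endpoints of e, delete e (parallel copies of e become loops)
contractEdge : (G : MGraph) → Fin (m G) → Gr
contractEdge G e =
  quot G (λ x → does (x ≟ proj₁ (endsG G e)) Data.Bool.∨ does (x ≟ proj₂ (endsG G e)))
         (λ f → not (does (f ≟ e)))

-- "w(e) is well defined and equals k"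
WeightIs : ℕ → (G : MGraph) → Fin (m G) → ℕ → Set
WeightIs δ G e k =
  (TwoConn (delete G e) → k ≡ 1) ×
  (TwoConn (contractEdge G e) → k ≡ δ ∸ 1) ×
  (TwoConn (delete G e) ⊎ TwoConn (contractEdge G e))

IsWeight : ℕ → (G : MGraph) → (Fin (m G) → ℕ) → Set
IsWeight δ G w = ∀ e → WeightIs δ G e (w e)

wE : (G : MGraph) → (Fin (m G) → ℕ) → Subset (n G) → ℕ
wE G w S = sumF (λ e → if inE G S e then w e else 0)

GoodFlat : (G : MGraph) → Subset (n G) → Set
GoodFlat G S =
  (∃[ x ] S x ≡ false) × TwoConn (induced G S) × TwoConn (contractSet G S)

Spade : ℕ → MGraph → Set
Spade δ G = Σ[ w ∈ (Fin (m G) → ℕ) ]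
  IsWeight δ G w ×
  (sumF w ≡ δ * (n G ∸ 1)) ×
  (∀ S → GoodFlat G S → wE G w S + 1 ≡ δ * (size S ∸ 1))

IsC2 : MGraph → Set
IsC2 G = (n G ≡ 2) × (m G ≡ 2) × LoopFree G

IsK4 : MGraph → Set
IsK4 G = (n G ≡ 4) × LoopFree G ×
  (∀ u v → u ≢ v →
     Σ[ e ∈ Fin (m G) ] (UEq (endsG G e) (u , v) ×
       (∀ f → UEq (endsG G f) (u , v) → f ≡ e)))

-- Construction A: H is (up to relabelling) obtained from G₁, G₂ by
-- gluing e₁ to e₂ and deleting the glued edge.

record ConstrA (δ : ℕ) (G₁ G₂ H : MGraph) : Set where
  field
    tc₁ : TwoConn (toGr G₁)
    tc₂ : TwoConn (toGr G₂)
    e₁  : Fin (m G₁)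
    e₂  : Fin (m G₂)
    w₁  : WeightIs δ G₁ e₁ 1
    w₂  : WeightIs δ G₂ e₂ (δ ∸ 1)
    φ₁  : Fin (n G₁) → Fin (n H)
    φ₂  : Fin (n G₂) → Fin (n H)
    φ₁-inj : ∀ x y → φ₁ x ≡ φ₁ y → x ≡ y
    φ₂-inj : ∀ x y → φ₂ x ≡ φ₂ y → x ≡ y
    cover  : ∀ z → (∃[ x ] φ₁ x ≡ z) ⊎ (∃[ y ] φ₂ y ≡ z)
    glue   : UEq (mapPair φ₁ (endsG G₁ e₁)) (mapPair φ₂ (endsG G₂ e₂))
    only-glue : ∀ x y → φ₁ x ≡ φ₂ y → (x ≡ proj₁ (endsG G₁ e₁)) ⊎ (x ≡ proj₂ (endsG G₁ e₁))
    ψ : ((Σ[ f ∈ Fin (m G₁) ] T (not (does (f ≟ e₁)))) ⊎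
         (Σ[ f ∈ Fin (m G₂) ] T (not (does (f ≟ e₂))))) ↔ Fin (m H)
    ψ-ends₁ : ∀ f → UEq (endsG H (Inverse.to ψ (inj₁ f))) (mapPair φ₁ (endsG G₁ (proj₁ f)))
    ψ-ends₂ : ∀ f → UEq (endsG H (Inverse.to ψ (inj₂ f))) (mapPair φ₂ (endsG G₂ (proj₁ f)))

data ClassA (δ : ℕ) : MGraph → Set where
  base : ∀ {G} → IsK4 G → ClassA δ G
  step : ∀ {G₁ G₂ H} → ClassA δ G₁ → ClassA δ G₂ → ConstrA δ G₁ G₂ H → ClassA δ H

{-# OPTIONS --safe #-}
-- Since 2-connectivity of G/E(S) amounts to connectedness of V ∖ S, the good flats S are the
-- 2-connected sets with connected complement, and (♠)₂ says |E| = 2|V| − 2 and |E(S)| = 2|S| − 3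
-- for these. If the complement of a 2-connected set S falls apart, adding either part to S keeps
-- it 2-connected, so by induction |E(S)| ≤ 2|S| − 4. Splitting at cut vertices then gives
-- |E(S)| ≤ 2|S| − 3 for every proper S with at least two vertices, with equality only at good
-- flats.
--
-- Without a 2-vertex cut every V ∖ {v} is a good flat, so all degrees are 3, |V| = 4 and G = K₄.
-- A 2-vertex cut {u , v} covers V by two sets meeting in {u , v}; counting forces equality in both
-- bounds, so u and v are not adjacent, both sides are 2-connected, and G arises from the two sides,
-- each with an additional edge uv, by Construction A.
--
-- A good flat of a graph obtained by Construction A contains all of one side or meets one side in
-- at most one end of the glued edge. The sets of these two kinds are good flats, and have
-- |E(S)| = 2|S| − 3, exactly when this holds for their traces on the other side. Hence (♠)₂ passes
-- from the two sides to the glued graph and back.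
module Submission where

open import Defs
open import Algebra.Bundles using (CommutativeMonoid)
open import Data.Bool using (Bool; true; false; not; _∧_; _∨_; T; if_then_else_)
open import Data.Bool.Properties as Bool
  using (T-≡; T-not-≡; T-irrelevant; T?; not-injective; ¬-not; ⇔→≡)
open import Data.Empty using (⊥; ⊥-elim)
open import Data.Fin using (Fin; zero; suc; #_; punchIn)
open import Data.Fin.Permutation using (Permutation)
open import Data.Fin.Properties as Fin using (any?; all?; +↔⊎)
open import Data.Nat using (ℕ; zero; suc; _+_; _*_; _∸_; _≤_; _<_; z≤n; s≤s)
open import Data.Nat.Induction using (Acc; acc; <-wellFounded)
open import Data.Nat.Properties as ℕ
open import Data.Nat.Tactic.RingSolver using (solve-∀)
open import Data.Product using (Σ-syntax; ∃; ∃-syntax; _×_; _,_; proj₁; proj₂; swap)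
open import Data.Sum as Sum using (_⊎_; inj₁; inj₂; [_,_]′)
open import Data.Sum.Function.Propositional using (_⊎-↔_)
open import Data.Sum.Properties using (inj₁-injective; inj₂-injective; swap-↔)
open import Data.Unit using (⊤; tt)
open import Data.Vec using (_∷_; []; lookup)
open import Function using (_∘_; id)
open import Function.Bundles using (Equivalence; Injection; Inverse; _⇔_; _↔_; mk⇔; mk↔ₛ′; mk↣)
open import Function.Definitions using (Injective)
open import Function.Properties.Inverse using (↔-trans; Inverse⇒Injection)
open import Relation.Binary using (DecidableEquality)
open import Relation.Binary.Construct.Closure.ReflexiveTransitive using (Star; ε; _◅_; _◅◅_; fold)
open import Relation.Binary.PropositionalEquality
open import Relation.Nullary using (¬_; Dec; yes; no; does)
open import Relation.Nullary.Decidable using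
  ( _×-dec_; _⊎-dec_; _→-dec_; ¬?; dec-true; dec-false; decidable-stable; from-yes; map′
  ; via-injection )
open import Relation.Unary using (Decidable; U; _≐_)

open import Algebra.Properties.CommutativeMonoid.Sum +-0-commutativeMonoid
  using (sum; sum-cong-≗; sum-replicate-zero; sum-remove; sum-permute; ∑-distrib-+; ∑-comm)
open import Algebra.Properties.CommutativeSemigroup
  (CommutativeMonoid.commutativeSemigroup +-0-commutativeMonoid)
  using () renaming (interchange to +-interchange)
open import Algebra.Properties.CommutativeSemigroup
  (CommutativeMonoid.commutativeSemigroup Bool.∧-commutativeMonoid)
  using () renaming (interchange to ∧-interchange)

private variable
  k l : ℕ
  H K : Gr

-- Subsets of Fin k

infix 4 _∈_ _∉_ _⊆_ _∈?_ _∉?_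
infixl 6 _∪_
infixl 7 _∩_

_∈_ _∉_ : Fin k → Subset k → Set
x ∈ S = S x ≡ true
x ∉ S = S x ≡ false

_⊆_ : Subset k → Subset k → Set
S ⊆ S′ = ∀ x → x ∈ S → x ∈ S′

Proper : Subset k → Set
Proper S = ∃[ x ] x ∉ S

_∈?_ : (x : Fin k) (S : Subset k) → Dec (x ∈ S)
x ∈? S = S x Bool.≟ true

_∉?_ : (x : Fin k) (S : Subset k) → Dec (x ∉ S)
x ∉? S = S x Bool.≟ false

∈⊎∉ : (x : Fin k) (S : Subset k) → x ∈ S ⊎ x ∉ S
∈⊎∉ x S with S x
... | true  = inj₁ refl
... | false = inj₂ refl

∈-∉-elim : {A : Set} {b : Bool} → b ≡ true → b ≡ false → A
∈-∉-elim refl ()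

T⇒≡true : {b : Bool} → T b → b ≡ true
T⇒≡true = Equivalence.to T-≡

≡true⇒T : {b : Bool} → b ≡ true → T b
≡true⇒T = Equivalence.from T-≡

∧-true⁻ : ∀ {a b} → a ∧ b ≡ true → a ≡ true × b ≡ true
∧-true⁻ {true} {true} _ = refl , refl

∨-true⁻ : ∀ {a b} → a ∨ b ≡ true → a ≡ true ⊎ b ≡ true
∨-true⁻ {true}  _ = inj₁ refl
∨-true⁻ {false} b = inj₂ b

∨-true⁺ˡ : ∀ {a} b → a ≡ true → a ∨ b ≡ true
∨-true⁺ˡ b refl = refl

∨-true⁺ʳ : ∀ a {b} → b ≡ true → a ∨ b ≡ true
∨-true⁺ʳ true  _ = refl
∨-true⁺ʳ false b = b

∨-false⁻ : ∀ {a b} → a ∨ b ≡ false → a ≡ false × b ≡ false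
∨-false⁻ {false} {false} _ = refl , refl

⊆-antisym : {S S′ : Subset k} → S ⊆ S′ → S′ ⊆ S → S ≗ S′
⊆-antisym S⊆S′ S′⊆S x = ⇔→≡ (mk⇔ (S⊆S′ x) (S′⊆S x))

⊆⇒∉ : {S S′ : Subset k} → S ⊆ S′ → ∀ x → x ∉ S′ → x ∉ S
⊆⇒∉ {S = S} S⊆S′ x x∉S′ with ∈⊎∉ x S
... | inj₁ x∈S = ∈-∉-elim (S⊆S′ x x∈S) x∉S′
... | inj₂ x∉S = x∉S

∅ full : Subset k
∅ _ = false
full _ = true

∁ : Subset k → Subset k
∁ S x = not (S x)

_∪_ _∩_ : Subset k → Subset k → Subset k
(S ∪ S′) x = S x ∨ S′ x
(S ∩ S′) x = S x ∧ S′ x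

⁅_⁆ : Fin k → Subset k
⁅ x ⁆ y = does (y Fin.≟ x)

x∈⁅x⁆ : (x : Fin k) → x ∈ ⁅ x ⁆
x∈⁅x⁆ x = dec-true (x Fin.≟ x) refl

x≢y⇒x∉⁅y⁆ : {x y : Fin k} → x ≢ y → x ∉ ⁅ y ⁆
x≢y⇒x∉⁅y⁆ {x = x} {y} = dec-false (x Fin.≟ y)

x∈⁅y⁆⇒x≡y : (x y : Fin k) → x ∈ ⁅ y ⁆ → x ≡ y
x∈⁅y⁆⇒x≡y x y x∈ with x Fin.≟ y
... | yes x≡y = x≡y
x∈⁅y⁆⇒x≡y x y () | no _

x∉⁅y⁆⇒x≢y : (x y : Fin k) → x ∉ ⁅ y ⁆ → x ≢ y
x∉⁅y⁆⇒x≢y x .x x∉ refl = ∈-∉-elim (x∈⁅x⁆ x) x∉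

x≢y⇒x∈∁⁅y⁆ : {x y : Fin k} → x ≢ y → x ∈ ∁ ⁅ y ⁆
x≢y⇒x∈∁⁅y⁆ x≢y = cong not (x≢y⇒x∉⁅y⁆ x≢y)

x∈∁⁅y⁆⇒x≢y : (x y : Fin k) → x ∈ ∁ ⁅ y ⁆ → x ≢ y
x∈∁⁅y⁆⇒x≢y x y x∈ = x∉⁅y⁆⇒x≢y x y (not-injective x∈)

⁅x⁆⊆ : {S : Subset k} {x : Fin k} → x ∈ S → ⁅ x ⁆ ⊆ S
⁅x⁆⊆ {S = S} {x} x∈S y y∈ = subst (_∈ S) (sym (x∈⁅y⁆⇒x≡y y x y∈)) x∈S

∪⊆ : {S S′ S″ : Subset k} → S ⊆ S″ → S′ ⊆ S″ → S ∪ S′ ⊆ S″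
∪⊆ {S = S} S⊆S″ S′⊆S″ x x∈ = [ S⊆S″ x , S′⊆S″ x ]′ (∨-true⁻ {S x} x∈)

pair : Fin k → Fin k → Subset k
pair u v = ⁅ u ⁆ ∪ ⁅ v ⁆

module _ (u v : Fin k) where

  ∈pairˡ : u ∈ pair u v
  ∈pairˡ = ∨-true⁺ˡ _ (x∈⁅x⁆ u)

  ∈pairʳ : v ∈ pair u v
  ∈pairʳ = ∨-true⁺ʳ _ (x∈⁅x⁆ v)

  ∈pair⁻ : ∀ {x} → x ∈ pair u v → x ≡ u ⊎ x ≡ v
  ∈pair⁻ {x} x∈ with ∨-true⁻ {⁅ u ⁆ x} x∈
  ... | inj₁ x∈⁅u⁆ = inj₁ (x∈⁅y⁆⇒x≡y x u x∈⁅u⁆)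
  ... | inj₂ x∈⁅v⁆ = inj₂ (x∈⁅y⁆⇒x≡y x v x∈⁅v⁆)

  ∈pair⁺ : ∀ {x} → x ≡ u ⊎ x ≡ v → x ∈ pair u v
  ∈pair⁺ (inj₁ refl) = ∈pairˡ
  ∈pair⁺ (inj₂ refl) = ∈pairʳ

  ∉pair⁻ : ∀ {x} → x ∉ pair u v → x ≢ u × x ≢ v
  ∉pair⁻ {x} x∉ =
    let x∉⁅u⁆ , x∉⁅v⁆ = ∨-false⁻ {⁅ u ⁆ x} x∉ in x∉⁅y⁆⇒x≢y x u x∉⁅u⁆ , x∉⁅y⁆⇒x≢y x v x∉⁅v⁆

  ∉pair⁺ : ∀ {x} → x ≢ u → x ≢ v → x ∉ pair u v
  ∉pair⁺ x≢u x≢v = cong₂ _∨_ (x≢y⇒x∉⁅y⁆ x≢u) (x≢y⇒x∉⁅y⁆ x≢v)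

  pair-comm : pair u v ≗ pair v u
  pair-comm x = Bool.∨-comm (⁅ u ⁆ x) (⁅ v ⁆ x)

  pair⊆ : {S : Subset k} → u ∈ S → v ∈ S → pair u v ⊆ S
  pair⊆ u∈S v∈S = ∪⊆ (⁅x⁆⊆ u∈S) (⁅x⁆⊆ v∈S)

Nontrivial : {A : Set} → (A → Set) → Set
Nontrivial P = ∃[ x ] ∃[ y ] (x ≢ y × P x × P y)

nontrivial-⊆ : {A : Set} {P Q : A → Set} → (∀ {x} → P x → Q x) → Nontrivial P → Nontrivial Q
nontrivial-⊆ P⊆Q (x , y , x≢y , px , py) = x , y , x≢y , P⊆Q px , P⊆Q py

nontrivial-avoid : {P : Fin k → Set} → Nontrivial P → ∀ v → ∃[ x ] (P x × x ≢ v)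
nontrivial-avoid (x , y , x≢y , px , py) v with x Fin.≟ v
... | no x≢v   = x , px , x≢v
... | yes refl = y , py , x≢y ∘ sym

∃⊎∀ : {A B : Fin k → Set} → (∀ x → A x ⊎ B x) → ∃ A ⊎ (∀ x → B x)
∃⊎∀ {zero}  f = inj₂ λ ()
∃⊎∀ {suc k} f with f zero | ∃⊎∀ (f ∘ suc)
... | inj₁ a | _            = inj₁ (zero , a)
... | inj₂ b | inj₁ (x , a) = inj₁ (suc x , a)
... | inj₂ b | inj₂ bs      = inj₂ λ { zero → b ; (suc x) → bs x }

-- Finite sums and cardinalities

sumF≡sum : (f : Fin k → ℕ) → sumF f ≡ sum f
sumF≡sum {zero}  f = refl
sumF≡sum {suc k} f = cong (f zero +_) (sumF≡sum (f ∘ suc))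

sumF-cong : {f g : Fin k → ℕ} → f ≗ g → sumF f ≡ sumF g
sumF-cong {f = f} {g} f≗g = trans (sumF≡sum f) (trans (sum-cong-≗ f≗g) (sym (sumF≡sum g)))

sum-const : ∀ k c → sum {k} (λ _ → c) ≡ k * c
sum-const zero    c = refl
sum-const (suc k) c = cong (c +_) (sum-const k c)

sum-zero : {f : Fin k → ℕ} → (∀ i → f i ≡ 0) → sum f ≡ 0
sum-zero {k} f≗0 = trans (sum-cong-≗ f≗0) (sum-replicate-zero k)

sum-mono-≤ : {f g : Fin k → ℕ} → (∀ i → f i ≤ g i) → sum f ≤ sum g
sum-mono-≤ {zero}  f≤g = z≤n
sum-mono-≤ {suc k} f≤g = +-mono-≤ (f≤g zero) (sum-mono-≤ (f≤g ∘ suc))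

sum-supported-at : {f : Fin k → ℕ} (i : Fin k) → (∀ j → j ≢ i → f j ≡ 0) → sum f ≡ f i
sum-supported-at {suc k} {f} i f≗0 = begin
  sum f                      ≡⟨ sum-remove {i = i} f ⟩
  f i + sum (f ∘ punchIn i)  ≡⟨ cong (f i +_) (sum-zero λ j → f≗0 _ (Fin.punchInᵢ≢i i j)) ⟩
  f i + 0                    ≡⟨ +-identityʳ (f i) ⟩
  f i                        ∎
  where open ≡-Reasoning

sum-⁅⁆ : (f : Fin k → ℕ) (i : Fin k) → sum (λ j → if ⁅ i ⁆ j then f j else 0) ≡ f i
sum-⁅⁆ f i = trans
  (sum-supported-at i λ j j≢i → cong (if_then f j else 0) (x≢y⇒x∉⁅y⁆ j≢i))
  (cong (if_then f i else 0) (x∈⁅x⁆ i))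

𝟙 : Bool → ℕ
𝟙 b = if b then 1 else 0

𝟙-mono : ∀ {a b} → (a ≡ true → b ≡ true) → 𝟙 a ≤ 𝟙 b
𝟙-mono {false} _     = z≤n
𝟙-mono {true}  a⇒b rewrite a⇒b refl = ≤-refl

∣_∣ : Subset k → ℕ
∣ S ∣ = sum (𝟙 ∘ S)

size≡∣∣ : (S : Subset k) → size S ≡ ∣ S ∣
size≡∣∣ S = sumF≡sum (𝟙 ∘ S)

∣∣-cong : {S S′ : Subset k} → S ≗ S′ → ∣ S ∣ ≡ ∣ S′ ∣
∣∣-cong S≗S′ = sum-cong-≗ (cong 𝟙 ∘ S≗S′)

∣full∣≡k : ∀ k → ∣ full {k} ∣ ≡ k
∣full∣≡k k = trans (sum-const k 1) (*-identityʳ k)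

all∈⇒∣S∣≡k : {S : Subset k} → (∀ x → x ∈ S) → ∣ S ∣ ≡ k
all∈⇒∣S∣≡k {k} all∈ = trans (∣∣-cong all∈) (∣full∣≡k k)

all∉⇒∣S∣≡0 : {S : Subset k} → (∀ x → x ∉ S) → ∣ S ∣ ≡ 0
all∉⇒∣S∣≡0 all∉ = sum-zero (cong 𝟙 ∘ all∉)

∣∅∣≡0 : ∀ k → ∣ ∅ {k} ∣ ≡ 0
∣∅∣≡0 = sum-replicate-zero

∣⁅x⁆∣≡1 : (x : Fin k) → ∣ ⁅ x ⁆ ∣ ≡ 1
∣⁅x⁆∣≡1 = sum-⁅⁆ (λ _ → 1)

⊆⇒∣∣≤ : {S S′ : Subset k} → S ⊆ S′ → ∣ S ∣ ≤ ∣ S′ ∣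
⊆⇒∣∣≤ S⊆S′ = sum-mono-≤ (𝟙-mono ∘ S⊆S′)

∣∪∣+∣∩∣ : (S S′ : Subset k) → ∣ S ∪ S′ ∣ + ∣ S ∩ S′ ∣ ≡ ∣ S ∣ + ∣ S′ ∣
∣∪∣+∣∩∣ S S′ = begin
  ∣ S ∪ S′ ∣ + ∣ S ∩ S′ ∣                       ≡⟨ ∑-distrib-+ (𝟙 ∘ (S ∪ S′)) _ ⟨
  sum (λ x → 𝟙 ((S ∪ S′) x) + 𝟙 ((S ∩ S′) x))  ≡⟨ sum-cong-≗ (λ x → pointwise (S x) (S′ x)) ⟩
  sum (λ x → 𝟙 (S x) + 𝟙 (S′ x))               ≡⟨ ∑-distrib-+ (𝟙 ∘ S) _ ⟩
  ∣ S ∣ + ∣ S′ ∣                                ∎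
  where
  open ≡-Reasoning
  pointwise : ∀ a b → 𝟙 (a ∨ b) + 𝟙 (a ∧ b) ≡ 𝟙 a + 𝟙 b
  pointwise true  true  = refl
  pointwise true  false = refl
  pointwise false true  = refl
  pointwise false false = refl

∣∪∣-disjoint : (S S′ : Subset k) → (∀ x → x ∈ S → x ∉ S′) → ∣ S ∪ S′ ∣ ≡ ∣ S ∣ + ∣ S′ ∣
∣∪∣-disjoint S S′ disjoint = begin
  ∣ S ∪ S′ ∣               ≡⟨ +-identityʳ _ ⟨
  ∣ S ∪ S′ ∣ + 0           ≡⟨ cong (∣ S ∪ S′ ∣ +_) (all∉⇒∣S∣≡0 {S = S ∩ S′} none) ⟨
  ∣ S ∪ S′ ∣ + ∣ S ∩ S′ ∣  ≡⟨ ∣∪∣+∣∩∣ S S′ ⟩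
  ∣ S ∣ + ∣ S′ ∣           ∎
  where
  open ≡-Reasoning
  none : ∀ x → x ∉ S ∩ S′
  none x with ∈⊎∉ x S
  ... | inj₁ x∈S = cong₂ _∧_ x∈S (disjoint x x∈S)
  ... | inj₂ x∉S = cong (_∧ S′ x) x∉S

∣S∣+∣∁S∣≡k : (S : Subset k) → ∣ S ∣ + ∣ ∁ S ∣ ≡ k
∣S∣+∣∁S∣≡k S =
  trans (sym (∣∪∣-disjoint S (∁ S) (λ _ → cong not))) (all∈⇒∣S∣≡k (λ x → Bool.∨-inverseʳ (S x)))

⊂⇒∣∣< : {S S′ : Subset k} → S ⊆ S′ → ∀ x → x ∉ S → x ∈ S′ → ∣ S ∣ < ∣ S′ ∣
⊂⇒∣∣< {S = S} {S′} S⊆S′ x x∉S x∈S′ = begin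
  suc ∣ S ∣          ≡⟨ cong (_+ ∣ S ∣) (∣⁅x⁆∣≡1 x) ⟨
  ∣ ⁅ x ⁆ ∣ + ∣ S ∣  ≡⟨ ∣∪∣-disjoint ⁅ x ⁆ S x-disjoint ⟨
  ∣ ⁅ x ⁆ ∪ S ∣      ≤⟨ ⊆⇒∣∣≤ (∪⊆ (⁅x⁆⊆ x∈S′) S⊆S′) ⟩
  ∣ S′ ∣             ∎
  where
  open ≤-Reasoning
  x-disjoint : ∀ y → y ∈ ⁅ x ⁆ → y ∉ S
  x-disjoint y y∈ = subst (_∉ S) (sym (x∈⁅y⁆⇒x≡y y x y∈)) x∉S

∁-⊂⇒∣∣< : {S S′ : Subset k} → S ⊆ S′ → ∀ x → x ∉ S → x ∈ S′ → ∣ ∁ S′ ∣ < ∣ ∁ S ∣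
∁-⊂⇒∣∣< S⊆S′ x x∉S x∈S′ = ⊂⇒∣∣<
  (λ y y∉S′ → cong not (⊆⇒∉ S⊆S′ y (not-injective y∉S′))) x (cong not x∈S′) (cong not x∉S)

proper⇒∣S∣<k : {S : Subset k} → Proper S → ∣ S ∣ < k
proper⇒∣S∣<k {k} {S} (x , x∉S) =
  subst (∣ S ∣ <_) (∣full∣≡k k) (⊂⇒∣∣< {S = S} (λ _ _ → refl) x x∉S refl)

x∈S⇒1≤∣S∣ : {S : Subset k} → ∀ x → x ∈ S → 1 ≤ ∣ S ∣
x∈S⇒1≤∣S∣ {S = S} x x∈S = subst (_≤ ∣ S ∣) (∣⁅x⁆∣≡1 x) (⊆⇒∣∣≤ (⁅x⁆⊆ {S = S} {x} x∈S))

∣pair∣≡2 : {u v : Fin k} → u ≢ v → ∣ pair u v ∣ ≡ 2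
∣pair∣≡2 {u = u} {v} u≢v = trans
  (∣∪∣-disjoint ⁅ u ⁆ ⁅ v ⁆ (λ x x∈ → x≢y⇒x∉⁅y⁆ (u≢v ∘ trans (sym (x∈⁅y⁆⇒x≡y x u x∈)))))
  (cong₂ _+_ (∣⁅x⁆∣≡1 u) (∣⁅x⁆∣≡1 v))

nontrivial⇒2≤∣S∣ : {S : Subset k} → Nontrivial (_∈ S) → 2 ≤ ∣ S ∣
nontrivial⇒2≤∣S∣ {S = S} (x , y , x≢y , x∈S , y∈S) =
  subst (_≤ ∣ S ∣) (∣pair∣≡2 x≢y) (⊆⇒∣∣≤ (pair⊆ x y x∈S y∈S))

∣∣-remove : (S : Subset k) (i : Fin k) → ∣ S ∩ ∁ ⁅ i ⁆ ∣ + 𝟙 (S i) ≡ ∣ S ∣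
∣∣-remove S i = begin
  ∣ S ∩ ∁ ⁅ i ⁆ ∣ + 𝟙 (S i)              ≡⟨ cong (∣ S ∩ ∁ ⁅ i ⁆ ∣ +_) (sum-⁅⁆ (𝟙 ∘ S) i) ⟨
  ∣ S ∩ ∁ ⁅ i ⁆ ∣ + sum at-i             ≡⟨ ∑-distrib-+ (𝟙 ∘ (S ∩ ∁ ⁅ i ⁆)) at-i ⟨
  sum (λ j → 𝟙 ((S ∩ ∁ ⁅ i ⁆) j) + at-i j)  ≡⟨ sum-cong-≗ (λ j → pointwise (S j) (⁅ i ⁆ j)) ⟩
  ∣ S ∣                                  ∎
  where
  open ≡-Reasoning
  at-i : Fin _ → ℕ
  at-i j = if ⁅ i ⁆ j then 𝟙 (S j) else 0
  pointwise : ∀ a b → 𝟙 (a ∧ not b) + (if b then 𝟙 a else 0) ≡ 𝟙 a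
  pointwise true  true  = refl
  pointwise true  false = refl
  pointwise false true  = refl
  pointwise false false = refl

Image : {A B : Set} → (A → B) → B → Set
Image φ z = ∃[ x ] φ x ≡ z

image? : (φ : Fin k → Fin l) (z : Fin l) → Dec (Image φ z)
image? φ z = any? λ x → φ x Fin.≟ z

image : (Fin k → Fin l) → Subset l
image φ z = does (image? φ z)

∈image⁻ : (φ : Fin k → Fin l) → ∀ z → z ∈ image φ → Image φ z
∈image⁻ φ z z∈ with image? φ z
... | yes z∈φ = z∈φ
∈image⁻ φ z () | no _

∈image⁺ : (φ : Fin k → Fin l) → ∀ {z} → Image φ z → z ∈ image φ
∈image⁺ φ {z} = dec-true (image? φ z)

∣∣-preimage : (φ : Fin k → Fin l) → Injective _≡_ _≡_ φ → (S : Subset l) →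
  ∣ S ∘ φ ∣ ≡ ∣ S ∩ image φ ∣
∣∣-preimage φ φ-injective S = begin
  sum (λ x → 𝟙 (S (φ x)))                ≡⟨ sum-cong-≗ (sum-⁅⁆ (𝟙 ∘ S) ∘ φ) ⟨
  sum (λ x → sum (λ z → incidence x z))  ≡⟨ ∑-comm incidence ⟩
  sum (λ z → sum (λ x → incidence x z))  ≡⟨ sum-cong-≗ column ⟩
  sum (λ z → 𝟙 ((S ∩ image φ) z))        ∎
  where
  open ≡-Reasoning
  incidence : _ → _ → ℕ
  incidence x z = if ⁅ φ x ⁆ z then 𝟙 (S z) else 0
  column : ∀ z → sum (λ x → incidence x z) ≡ 𝟙 ((S ∩ image φ) z)
  column z with image? φ z
  ... | no z∉φ = begin
    sum (λ x → incidence x z)  ≡⟨ sum-zero (λ x → cong (if_then 𝟙 (S z) else 0)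
                                    (x≢y⇒x∉⁅y⁆ (λ z≡φx → z∉φ (x , sym z≡φx)))) ⟩
    0                          ≡⟨ cong 𝟙 (Bool.∧-zeroʳ (S z)) ⟨
    𝟙 (S z ∧ false)            ∎
  ... | yes (x , refl) = begin
    sum (λ y → incidence y z)  ≡⟨ sum-supported-at x (λ y y≢x → cong (if_then 𝟙 (S z) else 0)
                                    (x≢y⇒x∉⁅y⁆ (y≢x ∘ φ-injective ∘ sym))) ⟩
    incidence x z              ≡⟨ cong (if_then 𝟙 (S z) else 0) (x∈⁅x⁆ z) ⟩
    𝟙 (S z)                    ≡⟨ cong 𝟙 (Bool.∧-identityʳ (S z)) ⟨
    𝟙 (S z ∧ true)             ∎

∣∣-cover : {j : ℕ} (φ : Fin k → Fin l) (χ : Fin j → Fin l) →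
  Injective _≡_ _≡_ φ → Injective _≡_ _≡_ χ → (∀ z → Image φ z ⊎ Image χ z) →
  (core : Subset l) → core ⊆ image φ → core ⊆ image χ → (∀ {x y} → φ x ≡ χ y → χ y ∈ core) →
  (S : Subset l) → ∣ S ∣ + ∣ S ∩ core ∣ ≡ ∣ S ∘ φ ∣ + ∣ S ∘ χ ∣
∣∣-cover φ χ φ-injective χ-injective cover core core⊆φ core⊆χ common∈core S = begin
  ∣ S ∣ + ∣ S ∩ core ∣
    ≡⟨ cong₂ _+_ (∣∣-cong union) (∣∣-cong intersection) ⟩
  ∣ S ∩ image φ ∪ S ∩ image χ ∣ + ∣ (S ∩ image φ) ∩ (S ∩ image χ) ∣
    ≡⟨ ∣∪∣+∣∩∣ (S ∩ image φ) (S ∩ image χ) ⟩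
  ∣ S ∩ image φ ∣ + ∣ S ∩ image χ ∣
    ≡⟨ cong₂ _+_ (∣∣-preimage φ φ-injective S) (∣∣-preimage χ χ-injective S) ⟨
  ∣ S ∘ φ ∣ + ∣ S ∘ χ ∣
    ∎
  where
  open ≡-Reasoning
  union : S ≗ S ∩ image φ ∪ S ∩ image χ
  union = ⊆-antisym
    (λ z z∈S → [ (λ z∈φ → ∨-true⁺ˡ _ (cong₂ _∧_ z∈S (∈image⁺ φ z∈φ)))
               , (λ z∈χ → ∨-true⁺ʳ ((S ∩ image φ) z) (cong₂ _∧_ z∈S (∈image⁺ χ z∈χ))) ]′ (cover z))
    (λ z z∈ → [ proj₁ ∘ ∧-true⁻ , proj₁ ∘ ∧-true⁻ ]′ (∨-true⁻ {(S ∩ image φ) z} z∈))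
  intersection : S ∩ core ≗ (S ∩ image φ) ∩ (S ∩ image χ)
  intersection = ⊆-antisym to from
    where
    to : S ∩ core ⊆ (S ∩ image φ) ∩ (S ∩ image χ)
    to z z∈ with ∧-true⁻ {S z} z∈
    ... | z∈S , z∈core =
      cong₂ _∧_ (cong₂ _∧_ z∈S (core⊆φ z z∈core)) (cong₂ _∧_ z∈S (core⊆χ z z∈core))
    from : (S ∩ image φ) ∩ (S ∩ image χ) ⊆ S ∩ core
    from z z∈ with ∧-true⁻ {(S ∩ image φ) z} z∈
    ... | z∈S∩φ , z∈S∩χ with ∧-true⁻ {S z} z∈S∩φ | ∧-true⁻ {S z} z∈S∩χ
    ... | z∈S , z∈φ | _ , z∈χ with ∈image⁻ φ z z∈φ | ∈image⁻ χ z z∈χ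
    ... | x , refl | y , χy≡φx = cong₂ _∧_ z∈S (subst (_∈ core) χy≡φx (common∈core (sym χy≡φx)))

Element : Subset k → Set
Element {k} S = Σ[ x ∈ Fin k ] T (S x)

Element-≡ : {S : Subset k} {a b : Element S} → proj₁ a ≡ proj₁ b → a ≡ b
Element-≡ {a = x , p} {_ , q} refl = cong (x ,_) (T-irrelevant p q)

enumerate : (S : Subset k) → Fin ∣ S ∣ ↔ Element S
enumerate {zero}  S = mk↔ₛ′ (λ ()) (λ ()) (λ ()) (λ ())
enumerate {suc k} S = ↔-trans +↔⊎ (↔-trans (Fin𝟙↔T (S zero) ⊎-↔ enumerate (S ∘ suc)) uncons)
  where
  Fin𝟙↔T : ∀ b → Fin (𝟙 b) ↔ T b
  Fin𝟙↔T true  = mk↔ₛ′ (λ _ → tt) (λ _ → zero) (λ _ → refl) (λ { zero → refl })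
  Fin𝟙↔T false = mk↔ₛ′ (λ ()) (λ ()) (λ ()) (λ ())
  uncons : (T (S zero) ⊎ Element (S ∘ suc)) ↔ Element S
  uncons = mk↔ₛ′
    (λ { (inj₁ p) → zero , p ; (inj₂ (x , p)) → suc x , p })
    (λ { (zero , p) → inj₁ p ; (suc x , p) → inj₂ (x , p) })
    (λ { (zero , p) → refl ; (suc x , p) → refl })
    (λ { (inj₁ p) → refl ; (inj₂ (x , p)) → refl })

module _ (S : Subset k) where

  open Inverse (enumerate S) using (to; from; strictlyInverseˡ; strictlyInverseʳ)

  element : Fin ∣ S ∣ → Fin k
  element = proj₁ ∘ to

  element∈ : ∀ i → element i ∈ S
  element∈ i = T⇒≡true (proj₂ (to i))

  element-injective : Injective _≡_ _≡_ element
  element-injective {i} {j} eq = begin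
    i            ≡⟨ strictlyInverseʳ i ⟨
    from (to i)  ≡⟨ cong from (Element-≡ eq) ⟩
    from (to j)  ≡⟨ strictlyInverseʳ j ⟩
    j            ∎
    where open ≡-Reasoning

  ∈⇒Image : ∀ {x} → x ∈ S → Image element x
  ∈⇒Image {x} x∈S = from (x , ≡true⇒T x∈S) , cong proj₁ (strictlyInverseˡ (x , ≡true⇒T x∈S))

  Image⇒∈ : ∀ {x} → Image element x → x ∈ S
  Image⇒∈ (i , refl) = element∈ i

  ∣∣-element : (S′ : Subset k) → ∣ S′ ∘ element ∣ ≡ ∣ S′ ∩ S ∣
  ∣∣-element S′ = trans (∣∣-preimage element element-injective S′)
    (∣∣-cong λ x → cong (S′ x ∧_) (image≗S x))
    where
    image≗S : image element ≗ S
    image≗S = ⊆-antisym (λ x → Image⇒∈ ∘ ∈image⁻ element x) (λ _ → ∈image⁺ element ∘ ∈⇒Image)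

-- Connectedness by colourings

end₁ end₂ : (G : MGraph) → Fin (m G) → Fin (n G)
end₁ G e = proj₁ (endsG G e)
end₂ G e = proj₂ (endsG G e)

data Link (H : Gr) : V H → V H → Set where
  forth : ∀ e → Link H (proj₁ (ends H e)) (proj₂ (ends H e))
  back  : ∀ e → Link H (proj₂ (ends H e)) (proj₁ (ends H e))

link : ∀ e {x y} → UEq (ends H e) (x , y) → Link H x y
link e (inj₁ (refl , refl)) = forth e
link e (inj₂ (refl , refl)) = back e

link-edge : ∀ {x y} → Link H x y → Σ[ e ∈ E H ] UEq (ends H e) (x , y)
link-edge (forth e) = e , inj₁ (refl , refl)
link-edge (back e)  = e , inj₂ (refl , refl)

link-sym : ∀ {x y} → Link H x y → Link H y x
link-sym (forth e) = back e
link-sym (back e)  = forth e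

LocallyConstant : (H : Gr) → (V H → Set) → (V H → Bool) → Set
LocallyConstant H P c = ∀ {x y} → P x → P y → Link H x y → c x ≡ c y

star-constant : {P : V H → Set} {c : V H → Bool} → LocallyConstant H P c →
  ∀ {x y} → Star (Adj H P) x y → c x ≡ c y
star-constant {c = c} lc =
  fold (λ x y → c x ≡ c y) (λ (px , py , e , e-ends) → trans (lc px py (link e e-ends))) refl

-- Colourings can be restricted, extended and pulled back where walks would have to be rerouted.
record Connected (H : Gr) (P : V H → Set) : Set where
  constructor connected
  field
    constant : ∀ {c} → LocallyConstant H P c → ∀ {x y} → P x → P y → c x ≡ c y

open Connected

connected-transfer : {P : V H → Set} {Q : V K → Set} → Connected H P →
  (∀ {c} → LocallyConstant K Q c →
     Σ[ d ∈ (V H → Bool) ] LocallyConstant H P d × (∀ {y} → Q y → ∃[ x ] P x × d x ≡ c y)) →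
  Connected K Q
connected-transfer con pull .constant lc qx qy with pull lc
... | d , lc′ , lift with lift qx | lift qy
... | x , px , dx | y , py , dy = trans (sym dx) (trans (constant con lc′ px py) dy)

connected-resp : {P Q : V H → Set} → P ≐ Q → Connected H P → Connected H Q
connected-resp (P⊆Q , Q⊆P) con = connected-transfer con λ {c} lc →
  c , (λ px py → lc (P⊆Q px) (P⊆Q py)) , (λ qy → _ , Q⊆P qy , refl)

connected-image : {P : V H → Set} {Q : V K → Set} (f : V H → V K) →
  (∀ {x} → P x → Q (f x)) → (∀ {y} → Q y → ∃[ x ] P x × f x ≡ y) →
  (∀ {x y} → P x → P y → Link H x y → f x ≡ f y ⊎ Link K (f x) (f y)) →
  Connected H P → Connected K Q
connected-image f P⊆Q onto links con = connected-transfer con λ {c} lc →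
  c ∘ f
  , (λ px py l → [ cong c , lc (P⊆Q px) (P⊆Q py) ]′ (links px py l))
  , (λ qy → let x , px , fx≡y = onto qy in x , px , cong c fx≡y)

infixl 6 _∖_
_∖_ : {A : Set} → (A → Set) → A → A → Set
(P ∖ v) x = P x × x ≢ v

∖-absent : {A : Set} {P : A → Set} {v : A} → ¬ P v → P ≐ (P ∖ v)
∖-absent ¬pv = (λ px → px , λ { refl → ¬pv px }) , proj₁

record Disconnection (H : Gr) (P : V H → Set) : Set where
  field
    colour          : V H → Bool
    locallyConstant : LocallyConstant H P colour
    {x y}           : V H
    Px              : P x
    Py              : P y
    x-true          : colour x ≡ true
    y-false         : colour y ≡ false

flip : {P : V H → Set} → Disconnection H P → Disconnection H P
flip D = record
  { colour = not ∘ colour ; locallyConstant = λ px py l → cong not (locallyConstant px py l)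
  ; Px = Py ; Py = Px ; x-true = cong not y-false ; y-false = cong not x-true }
  where open Disconnection D

disconnection-resp : {P Q : V H → Set} → P ≐ Q → Disconnection H P → Disconnection H Q
disconnection-resp (P⊆Q , Q⊆P) D = record
  { colour = colour ; locallyConstant = λ qx qy → locallyConstant (Q⊆P qx) (Q⊆P qy)
  ; Px = P⊆Q Px ; Py = P⊆Q Py ; x-true = x-true ; y-false = y-false }
  where open Disconnection D

-- Reachability in finite graphs

record Finite (H : Gr) : Set₁ where
  field
    {bound}         : ℕ
    index           : V H → Fin bound
    index-injective : Injective _≡_ _≡_ index
    anyEdge?        : {Q : E H → Set} → Decidable Q → Dec (∃ Q)

  _≟V_ : DecidableEquality (V H)
  _≟V_ = via-injection (mk↣ index-injective) Fin._≟_

  anyLink? : {Q : V H → V H → Set} → (∀ x y → Dec (Q x y)) → Dec (∃[ x ] ∃[ y ] Q x y × Link H x y)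
  anyLink? Q? = map′
    (λ { (e , inj₁ q) → _ , _ , q , forth e ; (e , inj₂ q) → _ , _ , q , back e })
    (λ { (_ , _ , q , forth e) → e , inj₁ q ; (_ , _ , q , back e) → e , inj₂ q })
    (anyEdge? λ e → Q? _ _ ⊎-dec Q? _ _)

module Reachability (finite : Finite H) {P : V H → Set} (P? : Decidable P) where

  open Finite finite

  Reached : V H → Subset bound → Set
  Reached x R = index x ∈ R × (∀ y → index y ∈ R → P y × Star (Adj H P) x y)

  Exit : Subset bound → V H → V H → Set
  Exit R y z = index y ∈ R × index z ∉ R × P y × P z

  exit⊎locallyConstant : ∀ R →
    (∃[ y ] ∃[ z ] Exit R y z × Link H y z) ⊎ LocallyConstant H P (R ∘ index)
  exit⊎locallyConstant R
    with anyLink? (λ y z → (index y ∈? R) ×-dec (index z ∉? R) ×-dec P? y ×-dec P? z)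
  ... | yes exit = inj₁ exit
  ... | no none  = inj₂ lc
    where
    lc : LocallyConstant H P (R ∘ index)
    lc {y} {z} py pz l with ∈⊎∉ (index y) R | ∈⊎∉ (index z) R
    ... | inj₁ y∈ | inj₁ z∈ = trans y∈ (sym z∈)
    ... | inj₂ y∉ | inj₂ z∉ = trans y∉ (sym z∉)
    ... | inj₁ y∈ | inj₂ z∉ = ⊥-elim (none (y , z , (y∈ , z∉ , py , pz) , l))
    ... | inj₂ y∉ | inj₁ z∈ = ⊥-elim (none (z , y , (z∈ , y∉ , pz , py) , link-sym l))

  reached-extend : ∀ {x R y z} → Reached x R → Exit R y z → Link H y z → Reached x (⁅ index z ⁆ ∪ R)
  reached-extend {x} {R} {y} {z} (x∈R , walk) (y∈R , _ , py , pz) l =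
    ∨-true⁺ʳ (⁅ index z ⁆ (index x)) x∈R , walk′
    where
    walk′ : ∀ w → index w ∈ ⁅ index z ⁆ ∪ R → P w × Star (Adj H P) x w
    walk′ w w∈ with ∨-true⁻ {⁅ index z ⁆ (index w)} w∈
    ... | inj₂ w∈R = walk w w∈R
    ... | inj₁ w∈⁅z⁆ with index-injective (x∈⁅y⁆⇒x≡y (index w) (index z) w∈⁅z⁆)
    ... | refl = pz , proj₂ (walk y y∈R) ◅◅ (py , pz , link-edge l) ◅ ε

  closure : ∀ {x} R → Acc _<_ ∣ ∁ R ∣ → Reached x R →
    ∃[ R′ ] Reached x R′ × LocallyConstant H P (R′ ∘ index)
  closure R (acc smaller) reached with exit⊎locallyConstant R
  ... | inj₂ lc = R , reached , lc
  ... | inj₁ (y , z , exit@(_ , z∉R , _) , l) =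
    closure (⁅ index z ⁆ ∪ R) (smaller ∁-smaller) (reached-extend {R = R} reached exit l)
    where
    ∁-smaller : ∣ ∁ (⁅ index z ⁆ ∪ R) ∣ < ∣ ∁ R ∣
    ∁-smaller = ∁-⊂⇒∣∣< {S = R} (λ w → ∨-true⁺ʳ (⁅ index z ⁆ w)) (index z) z∉R
      (∨-true⁺ˡ _ (x∈⁅x⁆ (index z)))

  reachable : ∀ x → P x → ∃[ R ] Reached x R × LocallyConstant H P (R ∘ index)
  reachable x px = closure ⁅ index x ⁆ (<-wellFounded _) (x∈⁅x⁆ (index x) , walk)
    where
    walk : ∀ y → index y ∈ ⁅ index x ⁆ → P y × Star (Adj H P) x y
    walk y y∈ with index-injective (x∈⁅y⁆⇒x≡y (index y) (index x) y∈)
    ... | refl = px , ε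

connectedOn⇒connected : {P : V H → Set} → ConnectedOn H P → Connected H P
connectedOn⇒connected con .constant lc px py = star-constant lc (con _ _ px py)

connected⇒connectedOn : {P : V H → Set} → Finite H → Decidable P → Connected H P → ConnectedOn H P
connected⇒connectedOn finite P? con x y px py with Reachability.reachable finite P? x px
... | R , (x∈R , walk) , lc = proj₂ (walk y (trans (sym (constant con lc px py)) x∈R))

finite-toGr : ∀ G → Finite (toGr G)
finite-toGr G = record { index = id ; index-injective = id ; anyEdge? = any? }

connected⊎disconnection : ∀ G {P : Fin (n G) → Set} → Decidable P →
  Connected (toGr G) P ⊎ Disconnection (toGr G) P
connected⊎disconnection G {P} P? with any? P?
... | no empty = inj₁ (connected λ _ px _ → ⊥-elim (empty (_ , px)))
... | yes (x , px) with Reachability.reachable (finite-toGr G) P? x px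
... | R , (x∈R , walk) , lc with any? (λ y → P? y ×-dec (y ∉? R))
... | yes (y , py , y∉R) = inj₂ (record
    { colour = R ; locallyConstant = lc ; Px = px ; Py = py ; x-true = x∈R ; y-false = y∉R })
... | no none = inj₁ (connected λ lc py pz →
    trans (sym (constant-from-x lc py)) (constant-from-x lc pz))
  where
  constant-from-x : ∀ {c} → LocallyConstant (toGr G) P c → ∀ {y} → P y → c x ≡ c y
  constant-from-x lc {y} py with ∈⊎∉ y R
  ... | inj₁ y∈R = star-constant lc (proj₂ (walk y y∈R))
  ... | inj₂ y∉R = ⊥-elim (none (y , py , y∉R))

-- Two-connectedness

Loopless : Gr → Set
Loopless H = ∀ e → proj₁ (ends H e) ≢ proj₂ (ends H e)

record Biconnected (H : Gr) (P : V H → Set) : Set where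
  field
    nontrivial : Nontrivial P
    whole      : Connected H P
    minus      : ∀ v → Connected H (P ∖ v)

biconnected-resp : {P Q : V H → Set} → P ≐ Q → Biconnected H P → Biconnected H Q
biconnected-resp P≐Q@(P⊆Q , Q⊆P) bi = record
  { nontrivial = nontrivial-⊆ P⊆Q (Biconnected.nontrivial bi)
  ; whole      = connected-resp P≐Q (Biconnected.whole bi)
  ; minus      = λ v → connected-resp
      ((λ (px , x≢v) → P⊆Q px , x≢v) , (λ (qx , x≢v) → Q⊆P qx , x≢v)) (Biconnected.minus bi v) }

record TwoConnected (H : Gr) : Set where
  field
    loopless    : Loopless H
    biconnected : Biconnected H U
  open Biconnected biconnected public

≢≐U∖ : {A : Set} {v : A} → (_≢ v) ≐ (U ∖ v)
≢≐U∖ = (tt ,_) , proj₂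

twoConn⇒twoConnected : TwoConn H → TwoConnected H
twoConn⇒twoConnected (loopless , (x , y , x≢y) , con , con-minus) = record
  { loopless    = loopless
  ; biconnected = record
    { nontrivial = x , y , x≢y , tt , tt
    ; whole      = connectedOn⇒connected con
    ; minus      = λ v → connected-resp ≢≐U∖ (connectedOn⇒connected (con-minus v)) } }

twoConnected⇒twoConn : Finite H → TwoConnected H → TwoConn H
twoConnected⇒twoConn finite tc = loopless
  , (let x , y , x≢y , _ = nontrivial in x , y , x≢y)
  , connected⇒connectedOn finite (λ _ → yes tt) whole
  , λ v → connected⇒connectedOn finite (λ x → ¬? (x ≟V v)) (connected-resp (swap ≢≐U∖) (minus v))
  where
  open TwoConnected tc
  open Finite finite

anyΣ? : {B : Fin k → Set} → Decidable B → (∀ {i} (p q : B i) → p ≡ q) →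
  {Q : Σ[ i ∈ Fin k ] B i → Set} → Decidable Q → Dec (∃ Q)
anyΣ? {B = B} B? B-irrelevant {Q} Q? =
  map′ (λ (i , b , q) → (i , b) , q) (λ ((i , b) , q) → i , b , q) (any? decide)
  where
  decide : ∀ i → Dec (Σ[ b ∈ B i ] Q (i , b))
  decide i with B? i
  ... | no ¬b = no (¬b ∘ proj₁)
  ... | yes b = map′ (b ,_)
    (λ (b′ , q) → subst (λ b → Q (i , b)) (B-irrelevant b′ b) q) (Q? (i , b))

-- Induced subgraphs

module _ {G : MGraph} {S : Subset (n G)} where

  finite-induced : Finite (induced G S)
  finite-induced = record
    { index = proj₁ ; index-injective = Element-≡
    ; anyEdge? = anyΣ? (λ e → T? _ ×-dec T? _)
        (λ (p , q) (p′ , q′) → cong₂ _,_ (T-irrelevant p p′) (T-irrelevant q q′)) }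

  private
    link-induced : ∀ {x y} (x∈S : T (S x)) (y∈S : T (S y)) → Link (toGr G) x y →
      Link (induced G S) (x , x∈S) (y , y∈S)
    link-induced p q (forth e) = forth (e , p , q)
    link-induced p q (back e)  = back (e , q , p)

    link-induced⁻ : ∀ {x y} → Link (induced G S) x y → Link (toGr G) (proj₁ x) (proj₁ y)
    link-induced⁻ (forth (e , _)) = forth e
    link-induced⁻ (back (e , _))  = back e

    extend-by-false : (Element S → Bool) → Fin (n G) → Bool
    extend-by-false c x with T? (S x)
    ... | yes x∈S = c (x , x∈S)
    ... | no _    = false

    extend-in : ∀ c {x} (x∈S : T (S x)) → extend-by-false c x ≡ c (x , x∈S)
    extend-in c {x} x∈S with T? (S x)
    ... | yes x∈S′ = cong c (Element-≡ refl)
    ... | no x∉S   = ⊥-elim (x∉S x∈S)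

  connected-induced⁺ : {P : Fin (n G) → Set} →
    Connected (toGr G) (λ x → x ∈ S × P x) → Connected (induced G S) (P ∘ proj₁)
  connected-induced⁺ con = connected-transfer con λ {c} lc →
    extend-by-false c
    , (λ (x∈S , px) (y∈S , py) l → let x∈ = ≡true⇒T x∈S ; y∈ = ≡true⇒T y∈S in
        trans (extend-in c x∈) (trans (lc px py (link-induced x∈ y∈ l)) (sym (extend-in c y∈))))
    , (λ {y} py → proj₁ y , (T⇒≡true (proj₂ y) , py) , extend-in c (proj₂ y))

  connected-induced⁻ : {P : Fin (n G) → Set} →
    Connected (induced G S) (P ∘ proj₁) → Connected (toGr G) (λ x → x ∈ S × P x)
  connected-induced⁻ = connected-image proj₁ (λ {x} px → T⇒≡true (proj₂ x) , px)
    (λ (y∈S , py) → (_ , ≡true⇒T y∈S) , py , refl) (λ _ _ l → inj₂ (link-induced⁻ l))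

  biconnected-induced⁻ : Biconnected (induced G S) U → Biconnected (toGr G) (_∈ S)
  biconnected-induced⁻ bi = record
    { nontrivial = let x , y , x≢y , _ = Biconnected.nontrivial bi in
        proj₁ x , proj₁ y , x≢y ∘ Element-≡ , T⇒≡true (proj₂ x) , T⇒≡true (proj₂ y)
    ; whole = whole-S ; minus = minus-S }
    where
    whole-S : Connected (toGr G) (_∈ S)
    whole-S = connected-resp (proj₁ , (_, tt)) (connected-induced⁻ (Biconnected.whole bi))
    minus-S : ∀ v → Connected (toGr G) ((_∈ S) ∖ v)
    minus-S v with ∈⊎∉ v S
    ... | inj₂ v∉S = connected-resp (∖-absent λ v∈S → ∈-∉-elim v∈S v∉S) whole-S
    ... | inj₁ v∈S = connected-induced⁻ {_≢ v} (connected-resp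
      ((λ (_ , x≢v) → x≢v ∘ Element-≡) , (λ x≢v → tt , x≢v ∘ cong proj₁))
      (Biconnected.minus bi (v , ≡true⇒T v∈S)))

  biconnected-induced⁺ : Biconnected (toGr G) (_∈ S) → Biconnected (induced G S) U
  biconnected-induced⁺ bi = record
    { nontrivial = let x , y , x≢y , x∈S , y∈S = Biconnected.nontrivial bi in
        (x , ≡true⇒T x∈S) , (y , ≡true⇒T y∈S) , x≢y ∘ cong proj₁ , tt , tt
    ; whole = connected-induced⁺ (connected-resp ((_, tt) , proj₁) (Biconnected.whole bi))
    ; minus = λ v → connected-resp
        ((λ x≢v → tt , x≢v ∘ cong proj₁) , (λ (_ , x≢v) → x≢v ∘ Element-≡))
        (connected-induced⁺ {_≢ proj₁ v} (Biconnected.minus bi (proj₁ v))) }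

-- Contractions

-- The second argument of the function behind `qmap` mentions `S x` in its type, so that `S x`
-- cannot be split on alone; this record lets both arguments be abstracted together.
record OutsideCase {X : Set} (R : X ⊎ ⊤ → Set) {b : Bool} (f : T (not b) → X) : Set where
  constructor outsideCase
  field at : ∀ p → R (inj₁ (f p))

module _ {G : MGraph} {S : Subset (n G)} where

  data QuotientView (x : Fin (n G)) : QV G S → Set where
    collapsed : x ∈ S → QuotientView x (inj₂ tt)
    retained  : x ∉ S → (p : T (not (S x))) → QuotientView x (inj₁ (x , p))

  private
    qmap-elim : ∀ x (R : QV G S → Set) →
      OutsideCase R {S x} (λ p → x , p) → (x ∈ S → R (inj₂ tt)) → R (qmap G S x)
    qmap-elim x R with S x | (λ (p : T (not (S x))) → _,_ {B = λ x → T (not (S x))} x p)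
    ... | true  | _ = λ _ r → r refl
    ... | false | _ = λ o _ → OutsideCase.at o tt

  quotientView : ∀ x → QuotientView x (qmap G S x)
  quotientView x = qmap-elim x (QuotientView x)
    (outsideCase λ p → retained (Equivalence.to T-not-≡ p) p) collapsed

  qmap-inside : ∀ {x} → x ∈ S → qmap G S x ≡ inj₂ tt
  qmap-inside {x} x∈S with qmap G S x | quotientView x
  ... | _ | collapsed _    = refl
  ... | _ | retained x∉S _ = ∈-∉-elim x∈S x∉S

  qmap-outside : ∀ {x} (p : T (not (S x))) → qmap G S x ≡ inj₁ (x , p)
  qmap-outside {x} p with qmap G S x | quotientView x
  ... | _ | collapsed x∈S = ∈-∉-elim x∈S (Equivalence.to T-not-≡ p)
  ... | _ | retained _ _  = cong inj₁ (Element-≡ refl)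

  qmap≢⇒∉ : ∀ {x} → qmap G S x ≢ inj₂ tt → x ∉ S
  qmap≢⇒∉ {x} ≢tt with qmap G S x | quotientView x
  ... | _ | collapsed _    = ⊥-elim (≢tt refl)
  ... | _ | retained x∉S _ = x∉S

  ∉⇒qmap≢ : ∀ {x} → x ∉ S → qmap G S x ≢ inj₂ tt
  ∉⇒qmap≢ {x} x∉S with qmap G S x | quotientView x
  ... | _ | collapsed x∈S = ∈-∉-elim x∈S x∉S
  ... | _ | retained _ _  = λ ()

  qmap-injective-outside : ∀ {x y} → x ∉ S → qmap G S x ≡ qmap G S y → x ≡ y
  qmap-injective-outside {x} {y} x∉S eq
    with qmap G S x | quotientView x | qmap G S y | quotientView y
  ... | _ | collapsed x∈S | _ | _ = ∈-∉-elim x∈S x∉S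
  qmap-injective-outside x∉S refl | _ | retained _ _ | _ | retained _ _ = refl

  finite-quot : (keep : Fin (m G) → Bool) → Finite (quot G S keep)
  finite-quot keep = record
    { index = λ { (inj₁ (x , _)) → suc x ; (inj₂ _) → zero }
    ; index-injective = λ { {inj₁ _} {inj₁ _} eq → cong inj₁ (Element-≡ (Fin.suc-injective eq))
                          ; {inj₂ _} {inj₂ _} _ → refl }
    ; anyEdge? = anyΣ? (λ _ → T? _) T-irrelevant }

  connected-outside : (keep : Fin (m G) → Bool) →
    Connected (quot G S keep) (_≢ inj₂ tt) → Connected (toGr G) (_∉ S)
  connected-outside keep con = connected-transfer con λ {c} lc →
    pull c , pull-lc lc , (λ {y} y∉S → qmap G S y , ∉⇒qmap≢ y∉S , pull-qmap c y∉S)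
    where
    pull : (Fin (n G) → Bool) → QV G S → Bool
    pull c = [ c ∘ proj₁ , (λ _ → true) ]′
    pull-qmap : ∀ c {x} → x ∉ S → pull c (qmap G S x) ≡ c x
    pull-qmap c {x} x∉S with qmap G S x | quotientView x
    ... | _ | collapsed x∈S = ∈-∉-elim x∈S x∉S
    ... | _ | retained _ _  = refl
    pull-link : ∀ {c} → LocallyConstant (toGr G) (_∉ S) c → ∀ {x y} →
      qmap G S x ≢ inj₂ tt → qmap G S y ≢ inj₂ tt → Link (toGr G) x y →
      pull c (qmap G S x) ≡ pull c (qmap G S y)
    pull-link {c} lc x≢ y≢ l = let x∉S = qmap≢⇒∉ x≢ ; y∉S = qmap≢⇒∉ y≢ in
      trans (pull-qmap c x∉S) (trans (lc x∉S y∉S l) (sym (pull-qmap c y∉S)))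
    pull-lc : ∀ {c} → LocallyConstant (toGr G) (_∉ S) c →
      LocallyConstant (quot G S keep) (_≢ inj₂ tt) (pull c)
    pull-lc lc x≢ y≢ (forth (e , _)) = pull-link lc x≢ y≢ (forth e)
    pull-lc lc x≢ y≢ (back (e , _))  = pull-link lc x≢ y≢ (back e)

  module _ (tc : TwoConnected (toGr G))
    (nonempty : ∃[ x ] x ∈ S) (proper : Proper S) (outside-connected : Connected (toGr G) (_∉ S))
    (keep : Fin (m G) → Bool) (keep≗ : keep ≗ ∁ (inE G S)) where

    private
      open TwoConnected tc
      Q : Gr
      Q = quot G S keep

      kept⊎inside : ∀ e → e ∈ keep ⊎ (end₁ G e ∈ S × end₂ G e ∈ S)
      kept⊎inside e with ∈⊎∉ e keep
      ... | inj₁ kept    = inj₁ kept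
      ... | inj₂ dropped = inj₂ (∧-true⁻ (not-injective (trans (sym (keep≗ e)) dropped)))

      qmap-link : ∀ {x y} → Link (toGr G) x y →
        qmap G S x ≡ qmap G S y ⊎ Link Q (qmap G S x) (qmap G S y)
      qmap-link (forth e) with kept⊎inside e
      ... | inj₁ kept      = inj₂ (forth (e , ≡true⇒T kept))
      ... | inj₂ (a∈ , b∈) = inj₁ (trans (qmap-inside a∈) (sym (qmap-inside b∈)))
      qmap-link (back e) with kept⊎inside e
      ... | inj₁ kept      = inj₂ (back (e , ≡true⇒T kept))
      ... | inj₂ (a∈ , b∈) = inj₁ (trans (qmap-inside b∈) (sym (qmap-inside a∈)))

      qmap-surjective : ∀ q → Image (qmap G S) q
      qmap-surjective (inj₁ (x , p)) = x , qmap-outside p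
      qmap-surjective (inj₂ tt)      = proj₁ nonempty , qmap-inside (proj₂ nonempty)

      connected-quot : {R : QV G S → Set} → Connected (toGr G) (R ∘ qmap G S) → Connected Q R
      connected-quot {R} = connected-image (qmap G S) id
        (λ {q} rq → let x , eq = qmap-surjective q in x , subst R (sym eq) rq , eq)
        (λ _ _ → qmap-link)

      quot-loopless : Loopless Q
      quot-loopless (e , p) eq with ∈⊎∉ (end₁ G e) S | ∈⊎∉ (end₂ G e) S
      ... | inj₂ a | _      = loopless e (qmap-injective-outside a eq)
      ... | inj₁ _ | inj₂ b = loopless e (sym (qmap-injective-outside b (sym eq)))
      ... | inj₁ a | inj₁ b = ∈-∉-elim (T⇒≡true p) (trans (keep≗ e) (cong not (cong₂ _∧_ a b)))

      minus-quot : ∀ q → Connected Q (U ∖ q)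
      minus-quot (inj₂ tt) = connected-quot (connected-resp
        ((λ x∉S → tt , ∉⇒qmap≢ x∉S) , (λ (_ , ≢tt) → qmap≢⇒∉ ≢tt)) outside-connected)
      minus-quot (inj₁ (v , p)) = connected-quot (connected-resp
        ( (λ (_ , x≢v) → tt , λ eq → x≢v (sym (qmap-injective-outside (Equivalence.to T-not-≡ p)
            (trans (qmap-outside p) (sym eq)))))
        , (λ (_ , ≢v) → tt , λ { refl → ≢v (qmap-outside p) })) (minus v))

    quot-twoConnected : TwoConnected Q
    quot-twoConnected = record
      { loopless = quot-loopless
      ; biconnected = record
        { nontrivial = let x , x∉S = proper in qmap G S x , inj₂ tt , ∉⇒qmap≢ x∉S , tt , tt
        ; whole      = connected-quot (connected-resp (id , id) whole)
        ; minus      = minus-quot } }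

record Good (G : MGraph) (S : Subset (n G)) : Set where
  field
    proper  : Proper S
    inside  : Biconnected (toGr G) (_∈ S)
    outside : Connected (toGr G) (_∉ S)

goodFlat⇒good : ∀ {G S} → GoodFlat G S → Good G S
goodFlat⇒good (proper , induced-tc , _ , _ , _ , contracted-minus) = record
  { proper  = proper
  ; inside  = biconnected-induced⁻ (TwoConnected.biconnected (twoConn⇒twoConnected induced-tc))
  ; outside = connected-outside _ (connectedOn⇒connected (contracted-minus (inj₂ tt))) }

good⇒goodFlat : ∀ {G S} → TwoConnected (toGr G) → Good G S → GoodFlat G S
good⇒goodFlat tc good = proper
  , twoConnected⇒twoConn finite-induced (record
    { loopless    = λ (e , _) eq → TwoConnected.loopless tc e (cong proj₁ eq)
    ; biconnected = biconnected-induced⁺ inside })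
  , twoConnected⇒twoConn (finite-quot _) (quot-twoConnected tc
      (let x , _ , _ , x∈S , _ = Biconnected.nontrivial inside in x , x∈S)
      proper outside _ (λ _ → refl))
  where open Good good

-- Attaching components of the complement

connected-subsingleton : {P : V H → Set} (v : V H) → (∀ {x} → P x → x ≡ v) → Connected H P
connected-subsingleton v only .constant {c} _ px py = cong c (trans (only px) (sym (only py)))

module _ {G : MGraph} {S c : Subset (n G)} (lc : LocallyConstant (toGr G) (_∉ S) c) where

  leaves-through-S : ∀ {x y} → Link (toGr G) x y → x ∈ c ∪ S → y ∉ c ∪ S → x ∈ S
  leaves-through-S {x} {y} l x∈ y∉ with ∨-true⁻ {c x} x∈ | ∨-false⁻ {c y} y∉ | ∈⊎∉ x S
  ... | inj₂ x∈S | _           | _        = x∈S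
  ... | inj₁ _   | _           | inj₁ x∈S = x∈S
  ... | inj₁ x∈c | y∉c , y∉S   | inj₂ x∉S = ∈-∉-elim (trans (sym (lc x∉S y∉S l)) x∈c) y∉c

  connected-attach : {P : Fin (n G) → Set} → ∃[ s ] (s ∈ S × P s) → Connected (toGr G) P →
    Connected (toGr G) (λ x → x ∈ S × P x) → Connected (toGr G) (λ x → x ∈ c ∪ S × P x)
  connected-attach {P} (s , s∈S , ps) con con-S = connected-transfer con λ {d} lc-d →
    retract d , retract-lc lc-d , (λ {y} (y∈ , py) → y , py , retract-in d y∈)
    where
    retract : (Fin (n G) → Bool) → Fin (n G) → Bool
    retract d z = if (c ∪ S) z then d z else d s

    retract-in : ∀ d {z} → z ∈ c ∪ S → retract d z ≡ d z
    retract-in d {z} z∈ rewrite z∈ = refl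

    retract-out : ∀ d {z} → z ∉ c ∪ S → retract d z ≡ d s
    retract-out d {z} z∉ rewrite z∉ = refl

    module _ {d} (lc-d : LocallyConstant (toGr G) (λ x → x ∈ c ∪ S × P x) d) where

      constant-on-S : ∀ {x} → x ∈ S → P x → d x ≡ d s
      constant-on-S x∈S px = constant con-S
        (λ {a} {b} (a∈S , pa) (b∈S , pb) → lc-d (∨-true⁺ʳ (c a) a∈S , pa) (∨-true⁺ʳ (c b) b∈S , pb))
        (x∈S , px) (s∈S , ps)

      retract-boundary : ∀ {x y} → P x → Link (toGr G) x y → x ∈ c ∪ S → y ∉ c ∪ S →
        retract d x ≡ retract d y
      retract-boundary {x} {y} px l x∈ y∉ = begin
        retract d x  ≡⟨ retract-in d x∈ ⟩
        d x          ≡⟨ constant-on-S (leaves-through-S l x∈ y∉) px ⟩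
        d s          ≡⟨ retract-out d y∉ ⟨
        retract d y  ∎
        where open ≡-Reasoning

      retract-lc : LocallyConstant (toGr G) P (retract d)
      retract-lc {x} {y} px py l with ∈⊎∉ x (c ∪ S) | ∈⊎∉ y (c ∪ S)
      ... | inj₁ x∈ | inj₁ y∈ =
        trans (retract-in d x∈) (trans (lc-d (x∈ , px) (y∈ , py) l) (sym (retract-in d y∈)))
      ... | inj₁ x∈ | inj₂ y∉ = retract-boundary px l x∈ y∉
      ... | inj₂ x∉ | inj₁ y∈ = sym (retract-boundary py (link-sym l) y∈ x∉)
      ... | inj₂ x∉ | inj₂ y∉ = trans (retract-out d x∉) (sym (retract-out d y∉))

  biconnected-attach : TwoConnected (toGr G) →
    Biconnected (toGr G) (_∈ S) → Biconnected (toGr G) (_∈ c ∪ S)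
  biconnected-attach tc bi = record
    { nontrivial = nontrivial-⊆ (λ {x} → ∨-true⁺ʳ (c x)) nontrivial
    ; whole = connected-resp (proj₁ , (_, tt))
        (connected-attach (let x , _ , _ , x∈S , _ = nontrivial in x , x∈S , tt)
          (TwoConnected.whole tc) (connected-resp ((_, tt) , proj₁) whole))
    ; minus = λ v → connected-resp drop-tt
        (connected-attach (let x , x∈S , x≢v = nontrivial-avoid nontrivial v in x , x∈S , tt , x≢v)
          (TwoConnected.minus tc v) (connected-resp (swap drop-tt) (minus v))) }
    where
    open Biconnected bi
    drop-tt : {A B : Fin (n G) → Set} → (λ x → A x × ⊤ × B x) ≐ (λ x → A x × B x)
    drop-tt = (λ (a , _ , b) → a , b) , (λ (a , b) → a , tt , b)

-- Deletion and contraction of an edge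

inE-pair⁻ : ∀ G {u v} → LoopFree G → ∀ e → e ∈ inE G (pair u v) → UEq (endsG G e) (u , v)
inE-pair⁻ G {u} {v} loopFree e e∈ with ∧-true⁻ e∈
... | a∈ , b∈ with ∈pair⁻ u v {end₁ G e} a∈ | ∈pair⁻ u v {end₂ G e} b∈
... | inj₁ a≡u | inj₂ b≡v = inj₁ (a≡u , b≡v)
... | inj₂ a≡v | inj₁ b≡u = inj₂ (a≡v , b≡u)
... | inj₁ a≡u | inj₁ b≡u = ⊥-elim (loopFree e (trans a≡u (sym b≡u)))
... | inj₂ a≡v | inj₂ b≡v = ⊥-elim (loopFree e (trans a≡v (sym b≡v)))

other : 2 ≤ k → (i : Fin k) → ∃[ j ] j ≢ i
other (s≤s (s≤s _)) zero    = suc zero , λ ()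
other (s≤s (s≤s _)) (suc i) = zero , λ ()

module DeleteContract {G : MGraph} (tc : TwoConnected (toGr G)) (f : Fin (m G)) where

  open TwoConnected tc

  private
    u v : Fin (n G)
    u = end₁ G f
    v = end₂ G f

    u≢v : u ≢ v
    u≢v = loopless f

  finite-delete : Finite (delete G f)
  finite-delete = record
    { index = id ; index-injective = id ; anyEdge? = anyΣ? (λ _ → T? _) T-irrelevant }

  link-delete : ∀ {x y} → Link (toGr G) x y → Link (delete G f) x y ⊎ UEq (u , v) (x , y)
  link-delete (forth e) with e Fin.≟ f
  ... | yes refl = inj₂ (inj₁ (refl , refl))
  ... | no e≢f   = inj₁ (forth (e , ≡true⇒T (cong not (x≢y⇒x∉⁅y⁆ e≢f))))
  link-delete (back e) with e Fin.≟ f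
  ... | yes refl = inj₂ (inj₂ (refl , refl))
  ... | no e≢f   = inj₁ (back (e , ≡true⇒T (cong not (x≢y⇒x∉⁅y⁆ e≢f))))

  connected-delete : {P : Fin (n G) → Set} → Connected (toGr G) P →
    (∀ {d} → LocallyConstant (delete G f) P d → P u → P v → d u ≡ d v) → Connected (delete G f) P
  connected-delete {P} con joined .constant {d} lc = constant con lc-G
    where
    lc-G : LocallyConstant (toGr G) P d
    lc-G px py l with link-delete l
    ... | inj₁ l′                   = lc px py l′
    ... | inj₂ (inj₁ (refl , refl)) = joined lc px py
    ... | inj₂ (inj₂ (refl , refl)) = sym (joined lc py px)

  delete-twoConnected :
    (∀ {d} → LocallyConstant (delete G f) U d → d u ≡ d v) →
    (∀ w {d} → LocallyConstant (delete G f) (U ∖ w) d → u ≢ w → v ≢ w → d u ≡ d v) →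
    TwoConnected (delete G f)
  delete-twoConnected joined joined-minus = record
    { loopless    = loopless ∘ proj₁
    ; biconnected = record
      { nontrivial = nontrivial
      ; whole      = connected-delete whole (λ lc _ _ → joined lc)
      ; minus      = λ w → connected-delete (minus w)
          (λ lc (_ , u≢w) (_ , v≢w) → joined-minus w lc u≢w v≢w) } }

  link-delete-avoiding : ∀ {w x y} → w ≡ u ⊎ w ≡ v → x ≢ w → y ≢ w →
    Link (toGr G) x y → Link (delete G f) x y
  link-delete-avoiding end x≢w y≢w l with link-delete l | end
  ... | inj₁ l′                   | _         = l′
  ... | inj₂ (inj₁ (refl , refl)) | inj₁ refl = ⊥-elim (x≢w refl)
  ... | inj₂ (inj₁ (refl , refl)) | inj₂ refl = ⊥-elim (y≢w refl)
  ... | inj₂ (inj₂ (refl , refl)) | inj₁ refl = ⊥-elim (y≢w refl)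
  ... | inj₂ (inj₂ (refl , refl)) | inj₂ refl = ⊥-elim (x≢w refl)

  module _ {P : Fin (n G) → Set} {c d : Fin (n G) → Bool} {x : Fin (n G)}
    (x∈c : x ∈ c) (lc-d : LocallyConstant (delete G f) P d) where

    -- In G - b every vertex of the side c of {a , b} is joined to a without using f.
    constant-on-side : ∀ {a b} → b ≡ u ⊎ b ≡ v → a ≢ b → LocallyConstant (toGr G) (_∉ pair a b) c →
      x ∉ pair a b → (∀ z → z ∈ c ∪ pair a b → P z) → d x ≡ d a
    constant-on-side {a} {b} b-end a≢b lc-c x∉ ⊆P = constant side-connected
      (λ {y} {z} (y∈ , _ , y≢b) (z∈ , _ , z≢b) l →
        lc-d (⊆P y y∈) (⊆P z z∈) (link-delete-avoiding b-end y≢b z≢b l))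
      (∨-true⁺ˡ _ x∈c , tt , proj₂ (∉pair⁻ a b x∉)) (∨-true⁺ʳ (c a) (∈pairˡ a b) , tt , a≢b)
      where
      only-a : ∀ {z} → z ∈ pair a b × ⊤ × z ≢ b → z ≡ a
      only-a (z∈ , _ , z≢b) = [ id , (λ z≡b → ⊥-elim (z≢b z≡b)) ]′ (∈pair⁻ a b z∈)
      side-connected : Connected (toGr G) (λ z → z ∈ c ∪ pair a b × ⊤ × z ≢ b)
      side-connected = connected-attach lc-c (a , ∈pairˡ a b , tt , a≢b) (minus b)
        (connected-subsingleton a only-a)

    joined-through : LocallyConstant (toGr G) (_∉ pair u v) c → x ∉ pair u v →
      (∀ z → z ∈ c ∪ pair u v → P z) → d u ≡ d v
    joined-through lc-c x∉ ⊆P = trans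
      (sym (constant-on-side (inj₂ refl) u≢v lc-c x∉ ⊆P))
      (constant-on-side (inj₁ refl) (u≢v ∘ sym)
        (λ {y} {z} y∉ z∉ → lc-c (∉pair-comm v u y y∉) (∉pair-comm v u z z∉)) (∉pair-comm u v x x∉)
        (λ z z∈ → ⊆P z (trans (cong (c z ∨_) (pair-comm u v z)) z∈)))
      where
      ∉pair-comm : ∀ a b z → z ∉ pair a b → z ∉ pair b a
      ∉pair-comm a b z = trans (pair-comm b a z)

  disconnected⇒delete : Disconnection (toGr G) (_∉ pair u v) → TwoConnected (delete G f)
  disconnected⇒delete D = delete-twoConnected
    (λ lc-d → joined-through x-true lc-d locallyConstant Px (λ _ _ → tt))
    joined-minus
    where
    open Disconnection D
    avoids : ∀ c {w} → u ≢ w → v ≢ w → w ∉ c → ∀ z → z ∈ c ∪ pair u v → ⊤ × z ≢ w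
    avoids c u≢w v≢w w∉c z z∈ = tt , λ { refl →
      ∈-∉-elim z∈ (cong₂ _∨_ w∉c (∉pair⁺ u v (u≢w ∘ sym) (v≢w ∘ sym))) }
    joined-minus : ∀ w {d} → LocallyConstant (delete G f) (U ∖ w) d → u ≢ w → v ≢ w → d u ≡ d v
    joined-minus w lc-d u≢w v≢w with ∈⊎∉ w colour
    ... | inj₂ w∉ = joined-through x-true lc-d locallyConstant Px (avoids colour u≢w v≢w w∉)
    ... | inj₁ w∈ = joined-through (cong not y-false) lc-d
      (Disconnection.locallyConstant (flip D)) Py (avoids (∁ colour) u≢w v≢w (cong not w∈))

  parallel⇒delete : ∀ g → g ≢ f → g ∈ inE G (pair u v) → TwoConnected (delete G f)
  parallel⇒delete g g≢f g∈ = delete-twoConnected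
    (λ lc → lc tt tt parallel) (λ w lc u≢w v≢w → lc (tt , u≢w) (tt , v≢w) parallel)
    where
    parallel : Link (delete G f) u v
    parallel = link (g , ≡true⇒T (cong not (x≢y⇒x∉⁅y⁆ g≢f))) (inE-pair⁻ G loopless g g∈)

  simple⇒contract : (∀ g → g ∈ inE G (pair u v) → g ≡ f) → Connected (toGr G) (_∉ pair u v) →
    Proper (pair u v) → TwoConnected (contractEdge G f)
  simple⇒contract simple con proper =
    quot-twoConnected tc (u , ∈pairˡ u v) proper con _ (cong not ∘ ⁅f⁆≗E[pair])
    where
    ⁅f⁆≗E[pair] : ⁅ f ⁆ ≗ inE G (pair u v)
    ⁅f⁆≗E[pair] = ⊆-antisym
      (⁅x⁆⊆ {S = inE G (pair u v)} (cong₂ _∧_ (∈pairˡ u v) (∈pairʳ u v)))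
      (λ g g∈ → subst (_∈ ⁅ f ⁆) (sym (simple g g∈)) (x∈⁅x⁆ f))

  -- The graphic case of Tutte's theorem on deletion and contraction in connected matroids.
  delete⊎contract : 2 ≤ m G → TwoConn (delete G f) ⊎ TwoConn (contractEdge G f)
  delete⊎contract 2≤m
    with any? (λ g → ¬? (g Fin.≟ f) ×-dec (g ∈? inE G (pair u v)))
       | connected⊎disconnection G (_∉? pair u v) | any? (_∉? pair u v)
  ... | yes (g , g≢f , g∈) | _ | _ =
    inj₁ (twoConnected⇒twoConn finite-delete (parallel⇒delete g g≢f g∈))
  ... | no _ | inj₂ D | _ = inj₁ (twoConnected⇒twoConn finite-delete (disconnected⇒delete D))
  ... | no none | inj₁ con | yes proper =
    inj₂ (twoConnected⇒twoConn (finite-quot _) (simple⇒contract simple con proper))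
    where
    simple : ∀ g → g ∈ inE G (pair u v) → g ≡ f
    simple g g∈ = decidable-stable (g Fin.≟ f) λ g≢f → none (g , g≢f , g∈)
  ... | no none | inj₁ _ | no ¬proper with other 2≤m f
  ... | g , g≢f = ⊥-elim (none (g , g≢f , cong₂ _∧_ (all∈ (end₁ G g)) (all∈ (end₂ G g))))
    where
    all∈ : ∀ x → x ∈ pair u v
    all∈ x = ¬-not λ x∉ → ¬proper (x , x∉)

-- The condition (♠)₂ without weights

edges : (G : MGraph) → Subset (n G) → ℕ
edges G S = ∣ inE G S ∣

Tight : (G : MGraph) → Subset (n G) → Set
Tight G S = edges G S + 3 ≡ 2 * ∣ S ∣

EdgeCount : MGraph → Set
EdgeCount G = m G + 2 ≡ 2 * n G

record Spade₂ (G : MGraph) : Set where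
  field
    edge-count : EdgeCount G
    tight      : ∀ S → Good G S → Tight G S

x≡2[a∸1]⇔x+2≡2a : ∀ {x a} → 1 ≤ a → x ≡ 2 * (a ∸ 1) ⇔ x + 2 ≡ 2 * a
x≡2[a∸1]⇔x+2≡2a {x} {suc a} _ = mk⇔
  (λ x≡ → trans (+-comm x 2) (trans (cong (2 +_) x≡) (sym (*-suc 2 a))))
  (λ x+2≡ → +-cancelˡ-≡ 2 x (2 * a) (trans (+-comm 2 x) (trans x+2≡ (*-suc 2 a))))

weight≡1 : ∀ {G w} → IsWeight 2 G w → ∀ e → w e ≡ 1
weight≡1 isWeight e with isWeight e
... | deleted , _ , inj₁ tc    = deleted tc
... | _ , contracted , inj₂ tc = contracted tc

module _ {G : MGraph} (tc : TwoConnected (toGr G)) where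

  2≤n : 2 ≤ n G
  2≤n = subst (2 ≤_) (∣full∣≡k (n G))
    (nontrivial⇒2≤∣S∣ (nontrivial-⊆ (λ _ → refl) (TwoConnected.nontrivial tc)))

  private
    1≤n : 1 ≤ n G
    1≤n = <⇒≤ 2≤n

    size-full : size (full {m G}) ≡ m G
    size-full = trans (size≡∣∣ (full {m G})) (∣full∣≡k (m G))

    1≤size : ∀ {S} → Good G S → 1 ≤ size S
    1≤size {S} good = subst (1 ≤_) (sym (size≡∣∣ S))
      (<⇒≤ (nontrivial⇒2≤∣S∣ (Biconnected.nontrivial (Good.inside good))))

    flat-count⇔tight : ∀ {S} → Good G S → size (inE G S) + 1 ≡ 2 * (size S ∸ 1) ⇔ Tight G S
    flat-count⇔tight {S} good = subst₂ (λ e s → size (inE G S) + 1 ≡ 2 * (size S ∸ 1) ⇔ e ≡ 2 * s)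
      (trans (+-assoc (size (inE G S)) 1 2) (cong (_+ 3) (size≡∣∣ (inE G S))))
      (size≡∣∣ S) (x≡2[a∸1]⇔x+2≡2a (1≤size good))

  spade⇒spade₂ : Spade 2 G → Spade₂ G
  spade⇒spade₂ (w , isWeight , total , flats) = record
    { edge-count = subst (λ x → x + 2 ≡ 2 * n G)
        (trans (sumF-cong (weight≡1 isWeight)) size-full)
        (Equivalence.to (x≡2[a∸1]⇔x+2≡2a 1≤n) total)
    ; tight = λ S good → Equivalence.to (flat-count⇔tight good)
        (trans (cong (_+ 1) (sym (unweighted S))) (flats S (good⇒goodFlat tc good))) }
    where
    unweighted : ∀ S → wE G w S ≡ size (inE G S)
    unweighted S = sumF-cong λ e → cong (if inE G S e then_else 0) (weight≡1 isWeight e)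

  weightIs1 : EdgeCount G → ∀ e → WeightIs 2 G e 1
  weightIs1 edge-count e = (λ _ → refl) , (λ _ → refl) , DeleteContract.delete⊎contract tc e 2≤m
    where
    2≤m : 2 ≤ m G
    2≤m = +-cancelʳ-≤ 2 2 (m G) (subst (4 ≤_) (sym edge-count) (*-monoʳ-≤ 2 2≤n))

  spade₂⇒spade : Spade₂ G → Spade 2 G
  spade₂⇒spade sp = (λ _ → 1) , weightIs1 edge-count
    , Equivalence.from (x≡2[a∸1]⇔x+2≡2a 1≤n) (trans (cong (_+ 2) size-full) edge-count)
    , λ S flat → let good = goodFlat⇒good flat in
        Equivalence.from (flat-count⇔tight good) (tight S good)
    where open Spade₂ sp

-- Splitting a set along a separation

Separation : (G : MGraph) → Subset (n G) → Subset (n G) → Set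
Separation G Q core = Disconnection (toGr G) (λ x → x ∈ Q × x ∉ core)

inE-⊆ : ∀ G {S S′} → S ⊆ S′ → inE G S ⊆ inE G S′
inE-⊆ G S⊆S′ e e∈ = let a , b = ∧-true⁻ e∈ in cong₂ _∧_ (S⊆S′ _ a) (S⊆S′ _ b)

inE-cong : ∀ G {S S′} → S ≗ S′ → inE G S ≗ inE G S′
inE-cong G S≗S′ e = cong₂ _∧_ (S≗S′ (end₁ G e)) (S≗S′ (end₂ G e))

module _ {G : MGraph} {Q core : Subset (n G)} where

  side : Separation G Q core → Subset (n G)
  side D = Q ∩ (Disconnection.colour D ∪ core)

  module _ (D : Separation G Q core) where

    open Disconnection D

    side⊆ : side D ⊆ Q
    side⊆ z z∈ = proj₁ (∧-true⁻ {Q z} z∈)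

    x∈side : x ∈ side D
    x∈side = cong₂ _∧_ (proj₁ Px) (∨-true⁺ˡ (core x) x-true)

    y∉side : y ∉ side D
    y∉side = cong₂ _∧_ (proj₁ Py) (cong₂ _∨_ y-false (proj₂ Py))

    ∣side∣<∣Q∣ : ∣ side D ∣ < ∣ Q ∣
    ∣side∣<∣Q∣ = ⊂⇒∣∣< side⊆ y y∉side (proj₁ Py)

    core⊆side : core ⊆ Q → core ⊆ side D
    core⊆side core⊆Q z z∈ = cong₂ _∧_ (core⊆Q z z∈) (∨-true⁺ʳ (colour z) z∈)

    ∣core∣<∣side∣ : core ⊆ Q → ∣ core ∣ < ∣ side D ∣
    ∣core∣<∣side∣ core⊆Q = ⊂⇒∣∣< (core⊆side core⊆Q) x (proj₂ Px) x∈side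

  module Sides (D : Separation G Q core) (core⊆Q : core ⊆ Q) where

    open Disconnection D

    L R : Subset (n G)
    L = side D
    R = side (flip D)

    core⊆L : core ⊆ L
    core⊆L = core⊆side D core⊆Q

    core⊆R : core ⊆ R
    core⊆R = core⊆side (flip D) core⊆Q

    L∪R≗Q : L ∪ R ≗ Q
    L∪R≗Q z = absorb (Q z) (colour z) (core z)
      where
      absorb : ∀ q c k → q ∧ (c ∨ k) ∨ q ∧ (not c ∨ k) ≡ q
      absorb false _     _     = refl
      absorb true  true  _     = refl
      absorb true  false true  = refl
      absorb true  false false = refl

    L∩R≗core : L ∩ R ≗ core
    L∩R≗core = ⊆-antisym common⇒core
      (λ z z∈ → cong₂ _∧_ (core⊆L z z∈) (core⊆R z z∈))
      where
      common⇒core : L ∩ R ⊆ core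
      common⇒core z z∈ with ∧-true⁻ {L z} z∈
      ... | z∈L , z∈R with ∨-true⁻ {colour z} (proj₂ (∧-true⁻ {Q z} z∈L))
                         | ∨-true⁻ {not (colour z)} (proj₂ (∧-true⁻ {Q z} z∈R))
      ... | inj₂ z∈core | _            = z∈core
      ... | inj₁ _      | inj₂ z∈core  = z∈core
      ... | inj₁ z-true | inj₁ z-false = ∈-∉-elim z-true (not-injective z-false)

    ∈Q⇒∈L⊎∈R : ∀ z → z ∈ Q → z ∈ L ⊎ z ∈ R
    ∈Q⇒∈L⊎∈R z z∈Q = ∨-true⁻ (trans (L∪R≗Q z) z∈Q)

    same-side : ∀ {a b} → Link (toGr G) a b → a ∈ Q → b ∈ Q → (a ∈ L × b ∈ L) ⊎ (a ∈ R × b ∈ R)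
    same-side {a} {b} l a∈Q b∈Q with ∈⊎∉ a core | ∈⊎∉ b core
    ... | inj₁ a∈ | _       = Sum.map (core⊆L a a∈ ,_) (core⊆R a a∈ ,_) (∈Q⇒∈L⊎∈R b b∈Q)
    ... | inj₂ _  | inj₁ b∈ = Sum.map (_, core⊆L b b∈) (_, core⊆R b b∈) (∈Q⇒∈L⊎∈R a a∈Q)
    ... | inj₂ a∉ | inj₂ b∉ with ∈⊎∉ a colour | locallyConstant (a∈Q , a∉) (b∈Q , b∉) l
    ... | inj₁ a-true  | a≡b = inj₁ (cong₂ _∧_ a∈Q (∨-true⁺ˡ _ a-true)
      , cong₂ _∧_ b∈Q (∨-true⁺ˡ _ (trans (sym a≡b) a-true)))
    ... | inj₂ a-false | a≡b = inj₂ (cong₂ _∧_ a∈Q (∨-true⁺ˡ _ (cong not a-false))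
      , cong₂ _∧_ b∈Q (∨-true⁺ˡ _ (cong not (trans (sym a≡b) a-false))))

    E[L]∪E[R]≗E[Q] : inE G L ∪ inE G R ≗ inE G Q
    E[L]∪E[R]≗E[Q] = ⊆-antisym
      (λ e e∈ → [ inE-⊆ G (side⊆ D) e , inE-⊆ G (side⊆ (flip D)) e ]′ (∨-true⁻ {inE G L e} e∈))
      (λ e e∈ → let a , b = ∧-true⁻ e∈ in
        [ (λ (a∈L , b∈L) → ∨-true⁺ˡ _ (cong₂ _∧_ a∈L b∈L))
        , (λ (a∈R , b∈R) → ∨-true⁺ʳ (inE G L e) (cong₂ _∧_ a∈R b∈R)) ]′ (same-side (forth e) a b))

    E[L]∩E[R]≗E[core] : inE G L ∩ inE G R ≗ inE G core
    E[L]∩E[R]≗E[core] e = trans (∧-interchange (L (end₁ G e)) _ _ _) (inE-cong G L∩R≗core e)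

    ∣L∣+∣R∣ : ∣ L ∣ + ∣ R ∣ ≡ ∣ Q ∣ + ∣ core ∣
    ∣L∣+∣R∣ = trans (sym (∣∪∣+∣∩∣ L R)) (cong₂ _+_ (∣∣-cong L∪R≗Q) (∣∣-cong L∩R≗core))

    edges-L+edges-R : edges G L + edges G R ≡ edges G Q + edges G core
    edges-L+edges-R = trans (sym (∣∪∣+∣∩∣ (inE G L) (inE G R)))
      (cong₂ _+_ (∣∣-cong E[L]∪E[R]≗E[Q]) (∣∣-cong E[L]∩E[R]≗E[core]))

    add-bounds : ∀ a b → edges G L + a ≤ 2 * ∣ L ∣ → edges G R + b ≤ 2 * ∣ R ∣ →
      edges G Q + edges G core + (a + b) ≤ 2 * (∣ Q ∣ + ∣ core ∣)
    add-bounds a b L≤ R≤ = begin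
      edges G Q + edges G core + (a + b)    ≡⟨ cong (_+ (a + b)) edges-L+edges-R ⟨
      edges G L + edges G R + (a + b)       ≡⟨ +-interchange (edges G L) (edges G R) a b ⟩
      edges G L + a + (edges G R + b)       ≤⟨ +-mono-≤ L≤ R≤ ⟩
      2 * ∣ L ∣ + 2 * ∣ R ∣                 ≡⟨ *-distribˡ-+ 2 ∣ L ∣ ∣ R ∣ ⟨
      2 * (∣ L ∣ + ∣ R ∣)                   ≡⟨ cong (2 *_) ∣L∣+∣R∣ ⟩
      2 * (∣ Q ∣ + ∣ core ∣)                ∎
      where open ≤-Reasoning

-- Sparsity

Sparse Slack : (G : MGraph) → Subset (n G) → Set
Sparse G S = edges G S + 3 ≤ 2 * ∣ S ∣
Slack  G S = edges G S + 4 ≤ 2 * ∣ S ∣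

edges-subsingleton : ∀ {G} → LoopFree G → {S : Subset (n G)} →
  (∀ {x y} → x ∈ S → y ∈ S → x ≡ y) → edges G S ≡ 0
edges-subsingleton {G} loopFree {S} unique = all∉⇒∣S∣≡0 λ e → ¬-not λ e∈ →
  let a , b = ∧-true⁻ {S (end₁ G e)} e∈ in loopFree e (unique a b)

module Sparsity {G : MGraph} (tc : TwoConnected (toGr G)) (sp : Spade₂ G) where

  open TwoConnected tc using (loopless)
  open Spade₂ sp

  good⊎slack⇒sparse : ∀ {S} → Good G S ⊎ Slack G S → Sparse G S
  good⊎slack⇒sparse {S} (inj₁ good)  = ≤-reflexive (tight S good)
  good⊎slack⇒sparse {S} (inj₂ slack) = ≤-trans (+-monoʳ-≤ (edges G S) (n≤1+n 3)) slack

  add-bounds-full : ∀ {core} (D : Separation G full core) a b →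
    edges G (side D) + a ≤ 2 * ∣ side D ∣ → edges G (side (flip D)) + b ≤ 2 * ∣ side (flip D) ∣ →
    edges G core + (a + b) ≤ 2 * ∣ core ∣ + 2
  add-bounds-full {core} D a b L≤ R≤ = +-cancelˡ-≤ (m G) _ _ (begin
    m G + (edges G core + (a + b))         ≡⟨ +-assoc (m G) (edges G core) (a + b) ⟨
    m G + edges G core + (a + b)           ≡⟨ cong (λ e → e + edges G core + (a + b)) ∣E∣≡m ⟨
    edges G full + edges G core + (a + b)  ≤⟨ Sides.add-bounds D (λ _ _ → refl) a b L≤ R≤ ⟩
    2 * (∣ full {n G} ∣ + ∣ core ∣)        ≡⟨ cong (λ s → 2 * (s + ∣ core ∣)) (∣full∣≡k (n G)) ⟩
    2 * (n G + ∣ core ∣)                   ≡⟨ *-distribˡ-+ 2 (n G) ∣ core ∣ ⟩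
    2 * n G + 2 * ∣ core ∣                 ≡⟨ cong (_+ 2 * ∣ core ∣) edge-count ⟨
    m G + 2 + 2 * ∣ core ∣                 ≡⟨ regroup (m G) (2 * ∣ core ∣) ⟩
    m G + (2 * ∣ core ∣ + 2)               ∎)
    where
    open ≤-Reasoning
    ∣E∣≡m : edges G full ≡ m G
    ∣E∣≡m = ∣full∣≡k (m G)
    regroup : ∀ m s → m + 2 + s ≡ m + (s + 2)
    regroup = solve-∀

  -- If the complement of S is disconnected, either of its parts can be added to S.
  biconnected⇒good⊎slack : ∀ {S} → Biconnected (toGr G) (_∈ S) → Proper S → Good G S ⊎ Slack G S
  biconnected⇒good⊎slack = rec (<-wellFounded _)
    where
    rec : ∀ {S} → Acc _<_ ∣ ∁ S ∣ → Biconnected (toGr G) (_∈ S) → Proper S → Good G S ⊎ Slack G S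
    rec {S} (acc smaller) bi proper with connected⊎disconnection G (_∉? S)
    ... | inj₁ con = inj₁ (record { proper = proper ; inside = bi ; outside = con })
    ... | inj₂ D   = inj₂ (+-cancelʳ-≤ 2 _ _ (≤-trans (≤-reflexive (+-assoc (edges G S) 4 2))
        (add-bounds-full D′ 3 3 (side-sparse D′) (side-sparse (flip D′)))))
      where
      D′ : Separation G full S
      D′ = disconnection-resp ((refl ,_) , proj₂) D
      side-sparse : (D : Separation G full S) → Sparse G (side D)
      side-sparse D = good⊎slack⇒sparse (rec
        (smaller (∁-⊂⇒∣∣< (core⊆side D (λ _ _ → refl)) x (proj₂ Px) (x∈side D)))
        (biconnected-attach (λ p q → locallyConstant (refl , p) (refl , q)) tc bi) (y , y∉side D))
        where open Disconnection D

  module _ {S : Subset (n G)}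
    (smaller-sparse : ∀ {T} → T ⊆ S → ∣ T ∣ < ∣ S ∣ → Nontrivial (_∈ T) → Sparse G T) where

    private
      weakly-sparse : ∀ {T} → T ⊆ S → ∣ T ∣ < ∣ S ∣ → ∀ x → x ∈ T → edges G T + 2 ≤ 2 * ∣ T ∣
      weakly-sparse {T} T⊆S T<S x x∈T with any? (λ y → ¬? (y Fin.≟ x) ×-dec (y ∈? T))
      ... | yes (y , y≢x , y∈T) = ≤-trans (+-monoʳ-≤ (edges G T) (n≤1+n 2))
        (smaller-sparse T⊆S T<S (y , x , y≢x , y∈T , x∈T))
      ... | no none = subst (λ e → e + 2 ≤ 2 * ∣ T ∣)
        (sym (edges-subsingleton {G} loopless {T} unique)) (*-monoʳ-≤ 2 (x∈S⇒1≤∣S∣ x x∈T))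
        where
        only-x : ∀ {y} → y ∈ T → y ≡ x
        only-x {y} y∈T = decidable-stable (y Fin.≟ x) λ y≢x → none (y , y≢x , y∈T)
        unique : ∀ {y z} → y ∈ T → z ∈ T → y ≡ z
        unique y∈T z∈T = trans (only-x y∈T) (sym (only-x z∈T))

    disconnected⇒slack : Disconnection (toGr G) (_∈ S) → Slack G S
    disconnected⇒slack D = begin
      edges G S + 4              ≤⟨ +-monoˡ-≤ 4 (m≤m+n (edges G S) (edges G ∅)) ⟩
      edges G S + edges G ∅ + 4  ≤⟨ Sides.add-bounds D′ (λ _ ()) 2 2 (bound D′) (bound (flip D′)) ⟩
      2 * (∣ S ∣ + ∣ ∅ {n G} ∣)  ≡⟨ cong (λ s → 2 * (∣ S ∣ + s)) (∣∅∣≡0 (n G)) ⟩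
      2 * (∣ S ∣ + 0)            ≡⟨ cong (2 *_) (+-identityʳ ∣ S ∣) ⟩
      2 * ∣ S ∣                  ∎
      where
      open ≤-Reasoning
      D′ : Separation G S ∅
      D′ = disconnection-resp ((_, refl) , proj₁) D
      bound : (D : Separation G S ∅) → edges G (side D) + 2 ≤ 2 * ∣ side D ∣
      bound D = weakly-sparse (side⊆ D) (∣side∣<∣Q∣ D) x (x∈side D)
        where open Disconnection D

    cutVertex⇒slack : ∀ {v} → v ∈ S → Disconnection (toGr G) ((_∈ S) ∖ v) → Slack G S
    cutVertex⇒slack {v} v∈S D = +-cancelʳ-≤ 2 _ _ (begin
      edges G S + 4 + 2              ≡⟨ +-assoc (edges G S) 4 2 ⟩
      edges G S + 6                  ≤⟨ +-monoˡ-≤ 6 (m≤m+n (edges G S) (edges G ⁅ v ⁆)) ⟩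
      edges G S + edges G ⁅ v ⁆ + 6  ≤⟨ Sides.add-bounds D′ (⁅x⁆⊆ v∈S) 3 3
                                          (sparse D′) (sparse (flip D′)) ⟩
      2 * (∣ S ∣ + ∣ ⁅ v ⁆ ∣)        ≡⟨ cong (λ s → 2 * (∣ S ∣ + s)) (∣⁅x⁆∣≡1 v) ⟩
      2 * (∣ S ∣ + 1)                ≡⟨ *-distribˡ-+ 2 ∣ S ∣ 1 ⟩
      2 * ∣ S ∣ + 2                  ∎)
      where
      open ≤-Reasoning
      D′ : Separation G S ⁅ v ⁆
      D′ = disconnection-resp
        ( (λ (x∈S , x≢v) → x∈S , x≢y⇒x∉⁅y⁆ x≢v)
        , (λ {x} (x∈S , x∉) → x∈S , x∉⁅y⁆⇒x≢y x v x∉)) D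
      sparse : (D : Separation G S ⁅ v ⁆) → Sparse G (side D)
      sparse D = smaller-sparse (side⊆ D) (∣side∣<∣Q∣ D)
        (x , v , x∉⁅y⁆⇒x≢y x v (proj₂ Px) , x∈side D , core⊆side D (⁅x⁆⊆ v∈S) v (x∈⁅x⁆ v))
        where open Disconnection D

  cutVertex⊎connected : ∀ {S} → Connected (toGr G) (_∈ S) →
    ∀ v → (v ∈ S × Disconnection (toGr G) ((_∈ S) ∖ v)) ⊎ Connected (toGr G) ((_∈ S) ∖ v)
  cutVertex⊎connected {S} con v with ∈⊎∉ v S
  ... | inj₂ v∉S = inj₂ (connected-resp (∖-absent λ v∈S → ∈-∉-elim v∈S v∉S) con)
  ... | inj₁ v∈S with connected⊎disconnection G (λ x → (x ∈? S) ×-dec ¬? (x Fin.≟ v))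
  ... | inj₁ con-v = inj₂ con-v
  ... | inj₂ D     = inj₁ (v∈S , D)

  good⊎slack : ∀ {S} → Proper S → Nontrivial (_∈ S) → Good G S ⊎ Slack G S
  good⊎slack = rec (<-wellFounded _)
    where
    rec : ∀ {S} → Acc _<_ ∣ S ∣ → Proper S → Nontrivial (_∈ S) → Good G S ⊎ Slack G S
    rec {S} (acc smaller) proper@(o , o∉S) nontrivial = cases (connected⊎disconnection G (_∈? S))
      where
      sparse-below : ∀ {T} → T ⊆ S → ∣ T ∣ < ∣ S ∣ → Nontrivial (_∈ T) → Sparse G T
      sparse-below T⊆S T<S T-nontrivial =
        good⊎slack⇒sparse (rec (smaller T<S) (o , ⊆⇒∉ T⊆S o o∉S) T-nontrivial)
      cases : Connected (toGr G) (_∈ S) ⊎ Disconnection (toGr G) (_∈ S) → Good G S ⊎ Slack G S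
      cases (inj₂ D) = inj₂ (disconnected⇒slack sparse-below D)
      cases (inj₁ con) with ∃⊎∀ (cutVertex⊎connected con)
      ... | inj₁ (v , v∈S , D) = inj₂ (cutVertex⇒slack sparse-below v∈S D)
      ... | inj₂ minus = biconnected⇒good⊎slack
        (record { nontrivial = nontrivial ; whole = con ; minus = minus }) proper

-- Separating pairs of vertices

module SeparatingPair {G : MGraph} (tc : TwoConnected (toGr G)) (sp : Spade₂ G)
  {u v : Fin (n G)} (u≢v : u ≢ v) where

  open Sparsity tc sp

  pair⊆side : (D : Separation G full (pair u v)) → pair u v ⊆ side D
  pair⊆side D = core⊆side D (λ _ _ → refl)

  side-good⊎slack : (D : Separation G full (pair u v)) → Good G (side D) ⊎ Slack G (side D)
  side-good⊎slack D = good⊎slack (y , y∉side D)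
    (u , v , u≢v , pair⊆side D u (∈pairˡ u v) , pair⊆side D v (∈pairʳ u v))
    where open Disconnection D

  side-sparse : (D : Separation G full (pair u v)) → Sparse G (side D)
  side-sparse D = good⊎slack⇒sparse (side-good⊎slack D)

  edges-pair+surplus≤6 : ∀ (D : Separation G full (pair u v)) a b →
    edges G (side D) + a ≤ 2 * ∣ side D ∣ → edges G (side (flip D)) + b ≤ 2 * ∣ side (flip D) ∣ →
    edges G (pair u v) + (a + b) ≤ 6
  edges-pair+surplus≤6 D a b L≤ R≤ = subst (λ s → edges G (pair u v) + (a + b) ≤ 2 * s + 2)
    (∣pair∣≡2 u≢v) (add-bounds-full D a b L≤ R≤)

  side-good : (D : Separation G full (pair u v)) → Good G (side D)
  side-good D with side-good⊎slack D
  ... | inj₁ good  = good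
  ... | inj₂ slack = ⊥-elim (<⇒≱ (m≤n+m 7 (edges G (pair u v)))
    (edges-pair+surplus≤6 D 4 3 slack (side-sparse (flip D))))

  non-adjacent : Separation G full (pair u v) → edges G (pair u v) ≡ 0
  non-adjacent D = n≤0⇒n≡0 (+-cancelʳ-≤ 6 _ 0
    (edges-pair+surplus≤6 D 3 3 (side-sparse D) (side-sparse (flip D))))

uEq? : (p q : Fin k × Fin k) → Dec (UEq p q)
uEq? (a , b) (c , d) = (a Fin.≟ c ×-dec b Fin.≟ d) ⊎-dec (a Fin.≟ d ×-dec b Fin.≟ c)

uEq-sym : {A : Set} {p q : A × A} → UEq p q → UEq q p
uEq-sym (inj₁ (refl , refl)) = inj₁ (refl , refl)
uEq-sym (inj₂ (refl , refl)) = inj₂ (refl , refl)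

uEq-trans : {A : Set} {p q r : A × A} → UEq p q → UEq q r → UEq p r
uEq-trans (inj₁ (refl , refl)) qr = qr
uEq-trans (inj₂ (refl , refl)) (inj₁ (refl , refl)) = inj₂ (refl , refl)
uEq-trans (inj₂ (refl , refl)) (inj₂ (refl , refl)) = inj₁ (refl , refl)

uEq-∧ : {A : Set} {p q : A × A} (S : A → Bool) → UEq p q →
  S (proj₁ p) ∧ S (proj₂ p) ≡ S (proj₁ q) ∧ S (proj₂ q)
uEq-∧ S (inj₁ (refl , refl)) = refl
uEq-∧ {q = q} S (inj₂ (refl , refl)) = Bool.∧-comm (S (proj₂ q)) (S (proj₁ q))

-- The 2-cycle and K₄ satisfy (♠)₂

good-size : ∀ {G S} → Good G S → 2 ≤ ∣ S ∣ × ∣ S ∣ < n G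
good-size good = nontrivial⇒2≤∣S∣ (Biconnected.nontrivial inside) , proper⇒∣S∣<k proper
  where open Good good

C₂⇒spade₂ : ∀ {G} → IsC2 G → Spade₂ G
C₂⇒spade₂ (n≡2 , m≡2 , _) = record
  { edge-count = trans (cong (_+ 2) m≡2) (cong (2 *_) (sym n≡2))
  ; tight      = λ S good → let 2≤S , S<n = good-size good in
      ⊥-elim (<⇒≱ (subst (∣ S ∣ <_) n≡2 S<n) 2≤S) }

spade₂⇒C₂ : ∀ {G} → LoopFree G → Spade₂ G → n G ≡ 2 → IsC2 G
spade₂⇒C₂ {G} loopFree sp n≡2 =
  n≡2 , +-cancelʳ-≡ 2 (m G) 2 (trans (Spade₂.edge-count sp) (cong (2 *_) n≡2)) , loopFree

K₄-ends : Fin 6 → Fin 4 × Fin 4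
K₄-ends = lookup
  ((# 0 , # 1) ∷ (# 0 , # 2) ∷ (# 0 , # 3) ∷ (# 1 , # 2) ∷ (# 1 , # 3) ∷ (# 2 , # 3) ∷ [])

K₄-loopless : ∀ j → proj₁ (K₄-ends j) ≢ proj₂ (K₄-ends j)
K₄-loopless = from-yes (all? λ j → ¬? (proj₁ (K₄-ends j) Fin.≟ proj₂ (K₄-ends j)))

K₄-complete : ∀ s t → s ≢ t → ∃[ j ] UEq (K₄-ends j) (s , t)
K₄-complete = from-yes (all? λ s → all? λ t →
  ¬? (s Fin.≟ t) →-dec any? λ j → uEq? (K₄-ends j) (s , t))

K₄-simple : ∀ i j → UEq (K₄-ends i) (K₄-ends j) → i ≡ j
K₄-simple = from-yes (all? λ i → all? λ j → uEq? (K₄-ends i) (K₄-ends j) →-dec (i Fin.≟ j))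

K₄-tight : (S : Subset 4) → 2 ≤ ∣ S ∣ → ∣ S ∣ < 4 →
  ∣ (λ j → S (proj₁ (K₄-ends j)) ∧ S (proj₂ (K₄-ends j))) ∣ + 3 ≡ 2 * ∣ S ∣
K₄-tight S 2≤S S<4 with S (# 0) | S (# 1) | S (# 2) | S (# 3)
K₄-tight S 2≤S (s≤s (s≤s (s≤s (s≤s ())))) | true | true | true | true
... | true  | true  | true  | false = refl
... | true  | true  | false | true  = refl
... | true  | true  | false | false = refl
... | true  | false | true  | true  = refl
... | true  | false | true  | false = refl
... | true  | false | false | true  = refl
... | false | true  | true  | true  = refl
... | false | true  | true  | false = refl
... | false | true  | false | true  = refl
... | false | false | true  | true  = refl
K₄-tight S (s≤s ()) S<4 | true  | false | false | false
K₄-tight S (s≤s ()) S<4 | false | true  | false | false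
K₄-tight S (s≤s ()) S<4 | false | false | true  | false
K₄-tight S (s≤s ()) S<4 | false | false | false | true
K₄-tight S ()       S<4 | false | false | false | false

K₄⇒spade₂ : ∀ {G} → IsK4 G → Spade₂ G
K₄⇒spade₂ {G@record { n = .4 ; m = m }} (refl , loopFree , unique) = record
  { edge-count = cong (_+ 2) (trans (sym (∣full∣≡k m)) (∣∣-permute full))
  ; tight = λ S good → let 2≤S , S<4 = good-size good in trans
      (cong (_+ 3) (trans (∣∣-permute (inE G S)) (∣∣-cong λ j → uEq-∧ S (edge-ends j))))
      (K₄-tight S 2≤S S<4) }
  where
  edge : Fin 6 → Fin m
  edge j = proj₁ (unique _ _ (K₄-loopless j))

  edge-ends : ∀ j → UEq (endsG G (edge j)) (K₄-ends j)
  edge-ends j = proj₁ (proj₂ (unique _ _ (K₄-loopless j)))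

  label : Fin m → Fin 6
  label f = proj₁ (K₄-complete _ _ (loopFree f))

  label-ends : ∀ f → UEq (K₄-ends (label f)) (endsG G f)
  label-ends f = proj₂ (K₄-complete _ _ (loopFree f))

  edge↔label : Permutation 6 m
  edge↔label = mk↔ₛ′ edge label
    (λ f → sym (proj₂ (proj₂ (unique _ _ (K₄-loopless (label f)))) f (uEq-sym (label-ends f))))
    (λ j → K₄-simple _ j (uEq-trans (label-ends (edge j)) (edge-ends j)))

  ∣∣-permute : (F : Subset m) → ∣ F ∣ ≡ ∣ F ∘ edge ∣
  ∣∣-permute F = sum-permute (𝟙 ∘ F) edge↔label

-- Without separating pairs of vertices

avoid-one : 3 ≤ k → (v : Fin k) → Nontrivial (_≢ v)
avoid-one (s≤s (s≤s (s≤s _))) zero          = # 1 , # 2 , (λ ()) , (λ ()) , (λ ())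
avoid-one (s≤s (s≤s (s≤s _))) (suc zero)    = # 0 , # 2 , (λ ()) , (λ ()) , (λ ())
avoid-one (s≤s (s≤s (s≤s _))) (suc (suc v)) = # 0 , # 1 , (λ ()) , (λ ()) , (λ ())

complementary-pair : k ≡ 4 → (u v : Fin k) → u ≢ v → ∃[ w ] ∃[ z ] (w ≢ z × pair w z ≗ ∁ (pair u v))
complementary-pair refl = from-yes (all? {4} λ u → all? λ v → ¬? (u Fin.≟ v) →-dec
  any? λ w → any? λ z → ¬? (w Fin.≟ z) ×-dec all? λ x → pair w z x Bool.≟ ∁ (pair u v) x)

biconnected-pair : ∀ {G} {u v : Fin (n G)} → u ≢ v → Link (toGr G) u v →
  Biconnected (toGr G) (_∈ pair u v)
biconnected-pair {G} {u} {v} u≢v l = record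
  { nontrivial = u , v , u≢v , ∈pairˡ u v , ∈pairʳ u v
  ; whole      = within id
  ; minus      = λ w → within proj₁ }
  where
  within : {P : Fin (n G) → Set} → (∀ {x} → P x → x ∈ pair u v) → Connected (toGr G) P
  within P⊆ .constant lc {x} {y} px py with ∈pair⁻ u v {x} (P⊆ px) | ∈pair⁻ u v {y} (P⊆ py)
  ... | inj₁ refl | inj₁ refl = refl
  ... | inj₂ refl | inj₂ refl = refl
  ... | inj₁ refl | inj₂ refl = lc px py l
  ... | inj₂ refl | inj₁ refl = lc px py (link-sym l)

module Inseparable {G : MGraph} (tc : TwoConnected (toGr G)) (sp : Spade₂ G) (3≤n : 3 ≤ n G)
  (inseparable : ∀ u v → u ≢ v → Connected (toGr G) (_∉ pair u v)) where

  open TwoConnected tc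
  open Spade₂ sp

  ∁⁅v⁆-good : ∀ v → Good G (∁ ⁅ v ⁆)
  ∁⁅v⁆-good v = record
    { proper  = v , cong not (x∈⁅x⁆ v)
    ; inside  = record
      { nontrivial = nontrivial-⊆ x≢y⇒x∈∁⁅y⁆ (avoid-one 3≤n v)
      ; whole      = connected-∁⁅v⁆
      ; minus      = connected-∁⁅v⁆-minus }
    ; outside = connected-subsingleton v λ {x} x∉ → x∈⁅y⁆⇒x≡y x v (not-injective x∉) }
    where
    connected-∁⁅v⁆ : Connected (toGr G) (_∈ ∁ ⁅ v ⁆)
    connected-∁⁅v⁆ = connected-resp
      ((λ (_ , x≢v) → x≢y⇒x∈∁⁅y⁆ x≢v) , (λ {x} x∈ → tt , x∈∁⁅y⁆⇒x≢y x v x∈)) (minus v)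
    connected-∁⁅v⁆-minus : ∀ w → Connected (toGr G) ((_∈ ∁ ⁅ v ⁆) ∖ w)
    connected-∁⁅v⁆-minus w with w Fin.≟ v
    ... | yes refl = connected-resp (∖-absent λ v∈ → x∈∁⁅y⁆⇒x≢y v v v∈ refl) connected-∁⁅v⁆
    ... | no w≢v   = connected-resp
      ( (λ {x} x∉ → let x≢v , x≢w = ∉pair⁻ v w {x} x∉ in x≢y⇒x∈∁⁅y⁆ x≢v , x≢w)
      , (λ {x} (x∈ , x≢w) → ∉pair⁺ v w (x∈∁⁅y⁆⇒x≢y x v x∈) x≢w)) (inseparable v w (w≢v ∘ sym))

  degree : Fin (n G) → ℕ
  degree v = sum λ e → 𝟙 (⁅ v ⁆ (end₁ G e)) + 𝟙 (⁅ v ⁆ (end₂ G e))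

  edges+degree≡m : ∀ v → edges G (∁ ⁅ v ⁆) + degree v ≡ m G
  edges+degree≡m v = begin
    edges G (∁ ⁅ v ⁆) + degree v
      ≡⟨ ∑-distrib-+ (𝟙 ∘ inE G (∁ ⁅ v ⁆)) _ ⟨
    sum (λ e → 𝟙 (inE G (∁ ⁅ v ⁆) e) + (𝟙 (⁅ v ⁆ (end₁ G e)) + 𝟙 (⁅ v ⁆ (end₂ G e))))
      ≡⟨ sum-cong-≗ counted-once ⟩
    ∣ full {m G} ∣
      ≡⟨ ∣full∣≡k (m G) ⟩
    m G
      ∎
    where
    open ≡-Reasoning
    counted-once : ∀ e →
      𝟙 (inE G (∁ ⁅ v ⁆) e) + (𝟙 (⁅ v ⁆ (end₁ G e)) + 𝟙 (⁅ v ⁆ (end₂ G e))) ≡ 1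
    counted-once e with end₁ G e Fin.≟ v | end₂ G e Fin.≟ v
    ... | yes a≡v | yes b≡v = ⊥-elim (loopless e (trans a≡v (sym b≡v)))
    ... | yes _   | no _    = refl
    ... | no _    | yes _   = refl
    ... | no _    | no _    = refl

  degree≡3 : ∀ v → degree v ≡ 3
  degree≡3 v = +-cancelˡ-≡ (edges G (∁ ⁅ v ⁆)) _ _
    (trans (edges+degree≡m v) (+-cancelʳ-≡ 2 _ _ (begin
      m G + 2                        ≡⟨ edge-count ⟩
      2 * n G                        ≡⟨ cong (2 *_) (∣S∣+∣∁S∣≡k ⁅ v ⁆) ⟨
      2 * (∣ ⁅ v ⁆ ∣ + ∣ ∁ ⁅ v ⁆ ∣)  ≡⟨ cong (λ s → 2 * (s + ∣ ∁ ⁅ v ⁆ ∣)) (∣⁅x⁆∣≡1 v) ⟩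
      2 * (1 + ∣ ∁ ⁅ v ⁆ ∣)          ≡⟨ *-distribˡ-+ 2 1 ∣ ∁ ⁅ v ⁆ ∣ ⟩
      2 + 2 * ∣ ∁ ⁅ v ⁆ ∣            ≡⟨ +-comm 2 _ ⟩
      2 * ∣ ∁ ⁅ v ⁆ ∣ + 2            ≡⟨ cong (_+ 2) (tight (∁ ⁅ v ⁆) (∁⁅v⁆-good v)) ⟨
      edges G (∁ ⁅ v ⁆) + 3 + 2      ∎)))
    where open ≡-Reasoning

  handshake : sum degree ≡ m G * 2
  handshake = begin
    sum degree
      ≡⟨ ∑-comm (λ v e → 𝟙 (⁅ v ⁆ (end₁ G e)) + 𝟙 (⁅ v ⁆ (end₂ G e))) ⟩
    sum (λ e → sum (λ v → 𝟙 (⁅ v ⁆ (end₁ G e)) + 𝟙 (⁅ v ⁆ (end₂ G e))))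
      ≡⟨ sum-cong-≗ (λ e → trans (∑-distrib-+ (λ v → 𝟙 (⁅ v ⁆ (end₁ G e))) _)
           (cong₂ _+_ (one-vertex (end₁ G e)) (one-vertex (end₂ G e)))) ⟩
    sum {m G} (λ _ → 2)
      ≡⟨ sum-const (m G) 2 ⟩
    m G * 2
      ∎
    where
    open ≡-Reasoning
    one-vertex : ∀ x → sum (λ v → 𝟙 (⁅ v ⁆ x)) ≡ 1
    one-vertex x = trans (sum-supported-at x (λ v v≢x → cong 𝟙 (x≢y⇒x∉⁅y⁆ (v≢x ∘ sym))))
      (cong 𝟙 (x∈⁅x⁆ x))

  n≡4 : n G ≡ 4
  n≡4 = sym (+-cancelˡ-≡ (n G * 3) 4 (n G) (begin
    n G * 3 + 4     ≡⟨ cong (_+ 4) (trans (sum-cong-≗ degree≡3) (sum-const (n G) 3)) ⟨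
    sum degree + 4  ≡⟨ cong (_+ 4) handshake ⟩
    m G * 2 + 4     ≡⟨ *-distribʳ-+ 2 (m G) 2 ⟨
    (m G + 2) * 2   ≡⟨ cong (_* 2) edge-count ⟩
    2 * n G * 2     ≡⟨ regroup (n G) ⟩
    n G * 3 + n G   ∎))
    where
    open ≡-Reasoning
    regroup : ∀ n → 2 * n * 2 ≡ n * 3 + n
    regroup = solve-∀

  adjacent : ∀ u v → u ≢ v → Σ[ e ∈ Fin (m G) ] UEq (endsG G e) (u , v)
  adjacent u v u≢v with any? (λ e → uEq? (endsG G e) (u , v)) | complementary-pair n≡4 u v u≢v
  ... | yes edge | _ = edge
  ... | no non-adjacent | w , z , w≢z , ≗∁ =
    ⊥-elim (∈-∉-elim (x∈⁅x⁆ u) (trans ⁅u⁆-constant (x≢y⇒x∉⁅y⁆ (u≢v ∘ sym))))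
    where
    u∉ : u ∉ pair w z
    u∉ = trans (≗∁ u) (cong not (∈pairˡ u v))
    v∉ : v ∉ pair w z
    v∉ = trans (≗∁ v) (cong not (∈pairʳ u v))
    u-or-v : ∀ x → x ∉ pair w z → x ≡ u ⊎ x ≡ v
    u-or-v x x∉ = ∈pair⁻ u v {x} (not-injective (trans (sym (≗∁ x)) x∉))
    lc : LocallyConstant (toGr G) (_∉ pair w z) ⁅ u ⁆
    lc {x} {y} x∉ y∉ l with u-or-v x x∉ | u-or-v y y∉
    ... | inj₁ refl | inj₁ refl = refl
    ... | inj₂ refl | inj₂ refl = refl
    ... | inj₁ refl | inj₂ refl = ⊥-elim (non-adjacent (link-edge l))
    ... | inj₂ refl | inj₁ refl = ⊥-elim (non-adjacent (link-edge (link-sym l)))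
    ⁅u⁆-constant : ⁅ u ⁆ u ≡ ⁅ u ⁆ v
    ⁅u⁆-constant = constant (inseparable w z w≢z) {⁅ u ⁆} lc {u} {v} u∉ v∉

  pair-good : ∀ {u v} → u ≢ v → Link (toGr G) u v → Good G (pair u v)
  pair-good {u} {v} u≢v l = record
    { proper  = let w , z , _ , ≗∁ = complementary-pair n≡4 u v u≢v in
        w , not-injective (trans (sym (≗∁ w)) (∈pairˡ w z))
    ; inside  = biconnected-pair u≢v l
    ; outside = inseparable u v u≢v }

  edges-pair≡1 : ∀ {u v} → u ≢ v → Link (toGr G) u v → edges G (pair u v) ≡ 1
  edges-pair≡1 {u} {v} u≢v l = +-cancelʳ-≡ 3 _ 1
    (trans (tight (pair u v) (pair-good u≢v l)) (cong (2 *_) (∣pair∣≡2 u≢v)))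

  isK₄ : IsK4 G
  isK₄ = n≡4 , loopless , unique-edge
    where
    unique-edge : ∀ u v → u ≢ v → Σ[ e ∈ Fin (m G) ] (UEq (endsG G e) (u , v) ×
      (∀ f → UEq (endsG G f) (u , v) → f ≡ e))
    unique-edge u v u≢v with adjacent u v u≢v
    ... | e , e-ends = e , e-ends , λ f f-ends → decidable-stable (f Fin.≟ e) λ f≢e →
        <⇒≱ (n<1+n 1) (subst (2 ≤_) (edges-pair≡1 u≢v (link e e-ends))
          (nontrivial⇒2≤∣S∣ (f , e , f≢e , within f f-ends , within e e-ends)))
      where
      within : ∀ f → UEq (endsG G f) (u , v) → f ∈ inE G (pair u v)
      within f f-ends = trans (uEq-∧ (pair u v) f-ends) (cong₂ _∧_ (∈pairˡ u v) (∈pairʳ u v))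

-- Construction A

∣∣-⊎ : (A : Subset k) (B : Subset l) {j : ℕ} (ψ : (Element A ⊎ Element B) ↔ Fin j)
  (F : Subset j) (F₁ : Subset k) (F₂ : Subset l) →
  (∀ a → F (Inverse.to ψ (inj₁ a)) ≡ F₁ (proj₁ a)) →
  (∀ b → F (Inverse.to ψ (inj₂ b)) ≡ F₂ (proj₁ b)) →
  ∣ F ∣ ≡ ∣ F₁ ∩ A ∣ + ∣ F₂ ∩ B ∣
∣∣-⊎ A B {j} ψ F F₁ F₂ F-left F-right = begin
  ∣ F ∣                                    ≡⟨ +-identityʳ ∣ F ∣ ⟨
  ∣ F ∣ + 0                                ≡⟨ cong (∣ F ∣ +_) ∣F∩∅∣≡0 ⟨
  ∣ F ∣ + ∣ F ∩ ∅ ∣                        ≡⟨ ∣∣-cover α β α-injective β-injective cover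
                                                ∅ (λ _ ()) (λ _ ()) disjoint F ⟩
  ∣ F ∘ α ∣ + ∣ F ∘ β ∣                    ≡⟨ cong₂ _+_ (∣∣-cong (F-left ∘ to (enumerate A)))
                                                        (∣∣-cong (F-right ∘ to (enumerate B))) ⟩
  ∣ F₁ ∘ element A ∣ + ∣ F₂ ∘ element B ∣  ≡⟨ cong₂ _+_ (∣∣-element A F₁) (∣∣-element B F₂) ⟩
  ∣ F₁ ∩ A ∣ + ∣ F₂ ∩ B ∣                  ∎
  where
  open ≡-Reasoning
  open Inverse using (to; from; strictlyInverseˡ)
  ∣F∩∅∣≡0 : ∣ F ∩ ∅ ∣ ≡ 0
  ∣F∩∅∣≡0 = all∉⇒∣S∣≡0 {S = F ∩ ∅} (λ h → Bool.∧-zeroʳ (F h))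
  ψ-injective : ∀ {x y} → to ψ x ≡ to ψ y → x ≡ y
  ψ-injective = Injection.injective (Inverse⇒Injection ψ)
  α : Fin ∣ A ∣ → Fin j
  α = to ψ ∘ inj₁ ∘ to (enumerate A)
  β : Fin ∣ B ∣ → Fin j
  β = to ψ ∘ inj₂ ∘ to (enumerate B)
  α-injective : Injective _≡_ _≡_ α
  α-injective = element-injective A ∘ cong proj₁ ∘ inj₁-injective ∘ ψ-injective
  β-injective : Injective _≡_ _≡_ β
  β-injective = element-injective B ∘ cong proj₁ ∘ inj₂-injective ∘ ψ-injective
  cover : ∀ h → Image α h ⊎ Image β h
  cover h with from ψ h | strictlyInverseˡ ψ h
  ... | inj₁ a | eq = inj₁ (from (enumerate A) a
    , trans (cong (to ψ ∘ inj₁) (strictlyInverseˡ (enumerate A) a)) eq)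
  ... | inj₂ b | eq = inj₂ (from (enumerate B) b
    , trans (cong (to ψ ∘ inj₂) (strictlyInverseˡ (enumerate B) b)) eq)
  disjoint : ∀ {x y} → α x ≡ β y → β y ∈ ∅
  disjoint eq with ψ-injective eq
  ... | ()

∣∣-glue : (e₁ : Fin k) (e₂ : Fin l) {j : ℕ}
  (ψ : (Element (∁ ⁅ e₁ ⁆) ⊎ Element (∁ ⁅ e₂ ⁆)) ↔ Fin j)
  (F : Subset j) (F₁ : Subset k) (F₂ : Subset l) →
  (∀ f → F (Inverse.to ψ (inj₁ f)) ≡ F₁ (proj₁ f)) →
  (∀ f → F (Inverse.to ψ (inj₂ f)) ≡ F₂ (proj₁ f)) →
  ∣ F ∣ + (𝟙 (F₁ e₁) + 𝟙 (F₂ e₂)) ≡ ∣ F₁ ∣ + ∣ F₂ ∣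
∣∣-glue e₁ e₂ ψ F F₁ F₂ F-left F-right = begin
  ∣ F ∣ + (𝟙 (F₁ e₁) + 𝟙 (F₂ e₂))
    ≡⟨ cong (_+ (𝟙 (F₁ e₁) + 𝟙 (F₂ e₂))) (∣∣-⊎ (∁ ⁅ e₁ ⁆) (∁ ⁅ e₂ ⁆) ψ F F₁ F₂ F-left F-right) ⟩
  ∣ F₁ ∩ ∁ ⁅ e₁ ⁆ ∣ + ∣ F₂ ∩ ∁ ⁅ e₂ ⁆ ∣ + (𝟙 (F₁ e₁) + 𝟙 (F₂ e₂))
    ≡⟨ +-interchange (∣ F₁ ∩ ∁ ⁅ e₁ ⁆ ∣) _ _ _ ⟩
  ∣ F₁ ∩ ∁ ⁅ e₁ ⁆ ∣ + 𝟙 (F₁ e₁) + (∣ F₂ ∩ ∁ ⁅ e₂ ⁆ ∣ + 𝟙 (F₂ e₂))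
    ≡⟨ cong₂ _+_ (∣∣-remove F₁ e₁) (∣∣-remove F₂ e₂) ⟩
  ∣ F₁ ∣ + ∣ F₂ ∣
    ∎
  where open ≡-Reasoning

uEq-ends : {A : Set} {p q : A × A} → UEq p q →
  ∀ {z} → z ≡ proj₁ p ⊎ z ≡ proj₂ p → z ≡ proj₁ q ⊎ z ≡ proj₂ q
uEq-ends (inj₁ (refl , refl)) end = end
uEq-ends (inj₂ (refl , refl)) end = Sum.swap end

uEq-map : {A B : Set} (f : A → B) {p q : A × A} → UEq p q → UEq (mapPair f p) (mapPair f q)
uEq-map f (inj₁ (refl , refl)) = inj₁ (refl , refl)
uEq-map f (inj₂ (refl , refl)) = inj₂ (refl , refl)

-- For δ = 2 both halves of the glued edge have weight 1.
constrA-sym : ∀ {G₁ G₂ H} → ConstrA 2 G₁ G₂ H → ConstrA 2 G₂ G₁ H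
constrA-sym {G₁} {G₂} C = record
  { tc₁ = tc₂ ; tc₂ = tc₁ ; e₁ = e₂ ; e₂ = e₁ ; w₁ = w₂ ; w₂ = w₁
  ; φ₁ = φ₂ ; φ₂ = φ₁ ; φ₁-inj = φ₂-inj ; φ₂-inj = φ₁-inj
  ; cover = Sum.swap ∘ cover ; glue = uEq-sym glue ; only-glue = only-glue-sym
  ; ψ = ↔-trans swap-↔ ψ ; ψ-ends₁ = ψ-ends₂ ; ψ-ends₂ = ψ-ends₁ }
  where
  open ConstrA C
  only-glue-sym : ∀ y x → φ₂ y ≡ φ₁ x → (y ≡ end₁ G₂ e₂) ⊎ (y ≡ end₂ G₂ e₂)
  only-glue-sym y x eq = Sum.map (φ₂-inj _ _) (φ₂-inj _ _)
    (uEq-ends glue (Sum.map φ₂y≡ φ₂y≡ (only-glue x y (sym eq))))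
    where
    φ₂y≡ : ∀ {x′} → x ≡ x′ → φ₂ y ≡ φ₁ x′
    φ₂y≡ x≡x′ = trans eq (cong φ₁ x≡x′)

good-resp : ∀ {G S S′} → S ≗ S′ → Good G S → Good G S′
good-resp S≗S′ good = record
  { proper  = let x , x∉S = proper in x , trans (sym (S≗S′ x)) x∉S
  ; inside  = biconnected-resp ((λ {x} → trans (sym (S≗S′ x))) , (λ {x} → trans (S≗S′ x))) inside
  ; outside = connected-resp ((λ {x} → trans (sym (S≗S′ x))) , (λ {x} → trans (S≗S′ x))) outside }
  where open Good good

tight-resp : ∀ {G S S′} → S ≗ S′ → Tight G S → Tight G S′
tight-resp {G} S≗S′ = subst₂ (λ e s → e + 3 ≡ 2 * s) (∣∣-cong (inE-cong G S≗S′)) (∣∣-cong S≗S′)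

module Glued {G₁ G₂ H : MGraph} (C : ConstrA 2 G₁ G₂ H) where

  open ConstrA C public

  u₁ v₁ : Fin (n G₁)
  u₁ = end₁ G₁ e₁
  v₁ = end₂ G₁ e₁

  u v : Fin (n H)
  u = φ₁ u₁
  v = φ₁ v₁

  u≢v : u ≢ v
  u≢v eq = proj₁ tc₁ e₁ (φ₁-inj _ _ eq)

  u∈φ₂ : Image φ₂ u
  u∈φ₂ with glue
  ... | inj₁ (u≡u₂ , _) = _ , sym u≡u₂
  ... | inj₂ (u≡v₂ , _) = _ , sym u≡v₂

  v∈φ₂ : Image φ₂ v
  v∈φ₂ with glue
  ... | inj₁ (_ , v≡v₂) = _ , sym v≡v₂
  ... | inj₂ (_ , v≡u₂) = _ , sym v≡u₂

  shared : ∀ {x y} → φ₁ x ≡ φ₂ y → φ₂ y ≡ u ⊎ φ₂ y ≡ v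
  shared {x} {y} eq = Sum.map φ₂y≡ φ₂y≡ (only-glue x y eq)
    where
    φ₂y≡ : ∀ {x′} → x ≡ x′ → φ₂ y ≡ φ₁ x′
    φ₂y≡ x≡x′ = trans (sym eq) (cong φ₁ x≡x′)

  link-φ₁ : ∀ {x y} → Link (toGr G₁) x y → UEq (u₁ , v₁) (x , y) ⊎ Link (toGr H) (φ₁ x) (φ₁ y)
  link-φ₁ l with link-edge l
  ... | f , f-ends with f Fin.≟ e₁
  ... | yes refl = inj₁ f-ends
  ... | no f≢e₁  = inj₂ (link (Inverse.to ψ (inj₁ f′)) (uEq-trans (ψ-ends₁ f′) (uEq-map φ₁ f-ends)))
    where
    f′ : Element (∁ ⁅ e₁ ⁆)
    f′ = f , ≡true⇒T (x≢y⇒x∈∁⁅y⁆ f≢e₁)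

  data LinkView : Fin (n H) → Fin (n H) → Set where
    on-left  : ∀ {x y} → Link (toGr G₁) x y → LinkView (φ₁ x) (φ₁ y)
    on-right : ∀ x y → LinkView (φ₂ x) (φ₂ y)

  linkView : ∀ {a b} → Link (toGr H) a b → LinkView a b
  linkView l with link-edge l
  ... | h , h-ends with Inverse.from ψ h | Inverse.strictlyInverseˡ ψ h
  ... | inj₁ (f , p) | refl with uEq-trans (uEq-sym h-ends) (ψ-ends₁ (f , p))
  ...   | inj₁ (refl , refl) = on-left (forth f)
  ...   | inj₂ (refl , refl) = on-left (back f)
  linkView l | h , h-ends | inj₂ (f , p) | refl with uEq-trans (uEq-sym h-ends) (ψ-ends₂ (f , p))
  ...   | inj₁ (refl , refl) = on-right _ _
  ...   | inj₂ (refl , refl) = on-right _ _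

  vertex-sum : ∀ S → ∣ S ∣ + ∣ S ∩ pair u v ∣ ≡ ∣ S ∘ φ₁ ∣ + ∣ S ∘ φ₂ ∣
  vertex-sum = ∣∣-cover φ₁ φ₂ (φ₁-inj _ _) (φ₂-inj _ _) cover (pair u v)
    (pair⊆ u v (∈image⁺ φ₁ (u₁ , refl)) (∈image⁺ φ₁ (v₁ , refl)))
    (pair⊆ u v (∈image⁺ φ₂ u∈φ₂) (∈image⁺ φ₂ v∈φ₂))
    (λ {x} {y} eq → ∈pair⁺ u v (shared {x} {y} eq))

  edge-sum : ∀ S → edges H S + (𝟙 (inE G₁ (S ∘ φ₁) e₁) + 𝟙 (inE G₂ (S ∘ φ₂) e₂)) ≡
    edges G₁ (S ∘ φ₁) + edges G₂ (S ∘ φ₂)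
  edge-sum S = ∣∣-glue e₁ e₂ ψ (inE H S) (inE G₁ (S ∘ φ₁)) (inE G₂ (S ∘ φ₂))
    (uEq-∧ S ∘ ψ-ends₁) (uEq-∧ S ∘ ψ-ends₂)

shift-⇔ : ∀ {a a′ b b′} c d → a + c ≡ a′ + d → b + c ≡ b′ + d → (a ≡ b) ⇔ (a′ ≡ b′)
shift-⇔ {a} {a′} {b} {b′} c d a~a′ b~b′ = mk⇔
  (λ a≡b → +-cancelʳ-≡ d a′ b′ (trans (sym a~a′) (trans (cong (_+ c) a≡b) b~b′)))
  (λ a′≡b′ → +-cancelʳ-≡ c a b (trans a~a′ (trans (cong (_+ d) a′≡b′) (sym b~b′))))

module _ {G₁ G₂ H : MGraph} (C : ConstrA 2 G₁ G₂ H) where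

  open Glued C

  extend : (Fin (n G₁) → Bool) → Bool → Fin (n H) → Bool
  extend d b z with image? φ₁ z
  ... | yes (x , _) = d x
  ... | no _        = b

  extend-φ₁ : ∀ d b x → extend d b (φ₁ x) ≡ d x
  extend-φ₁ d b x with image? φ₁ (φ₁ x)
  ... | yes (y , eq) = cong d (φ₁-inj y x eq)
  ... | no none      = ⊥-elim (none (x , refl))

  extend-φ₂ : ∀ d b y → (φ₂ y ≡ u → d u₁ ≡ b) → (φ₂ y ≡ v → d v₁ ≡ b) → extend d b (φ₂ y) ≡ b
  extend-φ₂ d b y at-u at-v with image? φ₁ (φ₂ y)
  ... | no _ = refl
  ... | yes (x , eq) with only-glue x y eq
  ... | inj₁ refl = at-u (sym eq)
  ... | inj₂ refl = at-v (sym eq)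

  -- The left graph is obtained from H by contracting the right side to the edge uv.
  connected-left : {P : Fin (n H) → Set} → Decidable P →
    Connected (toGr H) P → Connected (toGr G₁) (P ∘ φ₁)
  connected-left {P} P? con = connected-transfer con λ {d} lc →
    extend d (right-value d)
    , extend-lc lc
    , (λ {x} px → φ₁ x , px , extend-φ₁ d (right-value d) x)
    where
    right-value : (Fin (n G₁) → Bool) → Bool
    right-value d = if does (P? u) then d u₁ else d v₁
    module _ {d} (lc : LocallyConstant (toGr G₁) (P ∘ φ₁) d) where
      at-u : P u → d u₁ ≡ right-value d
      at-u pu rewrite dec-true (P? u) pu = refl
      at-v : P v → d v₁ ≡ right-value d
      at-v pv with P? u
      ... | yes pu = lc pv pu (back e₁)
      ... | no _   = refl
      on-right-side : ∀ y → P (φ₂ y) → extend d (right-value d) (φ₂ y) ≡ right-value d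
      on-right-side y py = extend-φ₂ d (right-value d) y
        (λ eq → at-u (subst P eq py)) (λ eq → at-v (subst P eq py))
      extend-lc : LocallyConstant (toGr H) P (extend d (right-value d))
      extend-lc pa pb l with linkView l
      ... | on-right x y = trans (on-right-side x pa) (sym (on-right-side y pb))
      ... | on-left {x} {y} l₁ = trans (extend-φ₁ d (right-value d) x)
        (trans (lc pa pb l₁) (sym (extend-φ₁ d (right-value d) y)))

  record RightAttached (P : Fin (n H) → Set) : Set where
    field
      right-connected : Connected (toGr H) (λ z → Image φ₂ z × P z)
      anchor          : ∀ y → P (φ₂ y) → P u ⊎ P v

  connected-glue : {P : Fin (n H) → Set} → Connected (toGr G₁) (P ∘ φ₁) → RightAttached P →
    Connected (toGr H) P
  connected-glue {P} con-left attached .constant {c} lc pa pb = compare (cover _) (cover _) pa pb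
    where
    open RightAttached attached

    right : ∀ {a b} → Image φ₂ a → Image φ₂ b → P a → P b → c a ≡ c b
    right a∈ b∈ pa pb =
      constant right-connected (λ (_ , pa) (_ , pb) → lc pa pb) (a∈ , pa) (b∈ , pb)

    lc-left : LocallyConstant (toGr G₁) (P ∘ φ₁) (c ∘ φ₁)
    lc-left px py l with link-φ₁ l
    ... | inj₂ l′                   = lc px py l′
    ... | inj₁ (inj₁ (refl , refl)) = right u∈φ₂ v∈φ₂ px py
    ... | inj₁ (inj₂ (refl , refl)) = right v∈φ₂ u∈φ₂ px py

    left : ∀ {x y} → P (φ₁ x) → P (φ₁ y) → c (φ₁ x) ≡ c (φ₁ y)
    left = constant con-left lc-left

    across : ∀ {x} y → P (φ₁ x) → P (φ₂ y) → c (φ₁ x) ≡ c (φ₂ y)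
    across y px py with anchor y py
    ... | inj₁ pu = trans (left px pu) (right u∈φ₂ (y , refl) pu py)
    ... | inj₂ pv = trans (left px pv) (right v∈φ₂ (y , refl) pv py)

    compare : ∀ {a b} → Image φ₁ a ⊎ Image φ₂ a → Image φ₁ b ⊎ Image φ₂ b → P a → P b → c a ≡ c b
    compare (inj₁ (x , refl)) (inj₁ (y , refl)) pa pb = left pa pb
    compare (inj₁ (x , refl)) (inj₂ (y , refl)) pa pb = across y pa pb
    compare (inj₂ (x , refl)) (inj₁ (y , refl)) pa pb = sym (across x pb pa)
    compare (inj₂ a∈)         (inj₂ b∈)         pa pb = right a∈ b∈ pa pb

  -- Traces of good sets on the two sides

  CoversRight : Subset (n H) → Set
  CoversRight S = ∀ y → φ₂ y ∈ S

  MeetsRightAt : Subset (n H) → Fin (n H) → Set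
  MeetsRightAt S w = (w ≡ u ⊎ w ≡ v) × (∀ y → φ₂ y ∈ S → φ₂ y ≡ w)

  RightCompatible : Subset (n H) → Set
  RightCompatible S = CoversRight S ⊎ (∃[ w ] MeetsRightAt S w)

  covers⇒∈ : ∀ {S z} → CoversRight S → Image φ₂ z → z ∈ S
  covers⇒∈ covers (y , refl) = covers y

  meetsAt-unique : ∀ {S w a b} → MeetsRightAt S w → Image φ₂ a → Image φ₂ b → a ∈ S → b ∈ S → a ≡ b
  meetsAt-unique (_ , only-w) (x , refl) (y , refl) a∈S b∈S =
    trans (only-w x a∈S) (sym (only-w y b∈S))

  meetsAt-excludes : ∀ {S w} → MeetsRightAt S w → u ∉ S ⊎ v ∉ S
  meetsAt-excludes {S} meets with ∈⊎∉ u S | ∈⊎∉ v S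
  ... | inj₂ u∉S | _        = inj₁ u∉S
  ... | inj₁ _   | inj₂ v∉S = inj₂ v∉S
  ... | inj₁ u∈S | inj₁ v∈S = ⊥-elim (u≢v (meetsAt-unique {S} meets u∈φ₂ v∈φ₂ u∈S v∈S))

  module _ {S : Subset (n H)} (covers : CoversRight S) where

    private
      pair⊆S : pair u v ⊆ S
      pair⊆S = pair⊆ u v (covers⇒∈ {S} covers u∈φ₂) (covers⇒∈ {S} covers v∈φ₂)

    covers-size : ∣ S ∣ + 2 ≡ ∣ S ∘ φ₁ ∣ + n G₂
    covers-size = begin
      ∣ S ∣ + 2                 ≡⟨ cong (∣ S ∣ +_) (∣pair∣≡2 u≢v) ⟨
      ∣ S ∣ + ∣ pair u v ∣      ≡⟨ cong (∣ S ∣ +_) (∣∣-cong S∩pair≗pair) ⟨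
      ∣ S ∣ + ∣ S ∩ pair u v ∣  ≡⟨ vertex-sum S ⟩
      ∣ S ∘ φ₁ ∣ + ∣ S ∘ φ₂ ∣   ≡⟨ cong (∣ S ∘ φ₁ ∣ +_) (all∈⇒∣S∣≡k covers) ⟩
      ∣ S ∘ φ₁ ∣ + n G₂         ∎
      where
      open ≡-Reasoning
      S∩pair≗pair : S ∩ pair u v ≗ pair u v
      S∩pair≗pair = ⊆-antisym (λ z z∈ → proj₂ (∧-true⁻ {S z} z∈))
        (λ z z∈ → cong₂ _∧_ (pair⊆S z z∈) z∈)

    covers-edges : edges H S + 2 ≡ edges G₁ (S ∘ φ₁) + m G₂
    covers-edges = begin
      edges H S + 2
        ≡⟨ cong₂ (λ a b → edges H S + (𝟙 a + 𝟙 b)) e₁∈ (all-edges₂ e₂) ⟨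
      edges H S + (𝟙 (inE G₁ (S ∘ φ₁) e₁) + 𝟙 (inE G₂ (S ∘ φ₂) e₂))
        ≡⟨ edge-sum S ⟩
      edges G₁ (S ∘ φ₁) + edges G₂ (S ∘ φ₂)
        ≡⟨ cong (edges G₁ (S ∘ φ₁) +_) (all∈⇒∣S∣≡k all-edges₂) ⟩
      edges G₁ (S ∘ φ₁) + m G₂
        ∎
      where
      open ≡-Reasoning
      e₁∈ : e₁ ∈ inE G₁ (S ∘ φ₁)
      e₁∈ = cong₂ _∧_ (pair⊆S u (∈pairˡ u v)) (pair⊆S v (∈pairʳ u v))
      all-edges₂ : ∀ g → g ∈ inE G₂ (S ∘ φ₂)
      all-edges₂ g = cong₂ _∧_ (covers _) (covers _)

    covers-tight : EdgeCount G₂ → Tight G₁ (S ∘ φ₁) ⇔ Tight H S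
    covers-tight edge-count₂ = shift-⇔ (m G₂ + 2) 4
      (begin
        f + 3 + (m G₂ + 2)     ≡⟨ regroup f (m G₂) ⟩
        f + m G₂ + 5           ≡⟨ cong (_+ 5) covers-edges ⟨
        edges H S + 2 + 5      ≡⟨ trans (+-assoc (edges H S) 2 5) (sym (+-assoc (edges H S) 3 4)) ⟩
        edges H S + 3 + 4      ∎)
      (begin
        2 * s + (m G₂ + 2)     ≡⟨ cong (2 * s +_) edge-count₂ ⟩
        2 * s + 2 * n G₂       ≡⟨ *-distribˡ-+ 2 s (n G₂) ⟨
        2 * (s + n G₂)         ≡⟨ cong (2 *_) covers-size ⟨
        2 * (∣ S ∣ + 2)        ≡⟨ *-distribˡ-+ 2 ∣ S ∣ 2 ⟩
        2 * ∣ S ∣ + 4          ∎)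
      where
      open ≡-Reasoning
      f s : ℕ
      f = edges G₁ (S ∘ φ₁)
      s = ∣ S ∘ φ₁ ∣
      regroup : ∀ f m → f + 3 + (m + 2) ≡ f + m + 5
      regroup = solve-∀

  module _ {S : Subset (n H)} {w : Fin (n H)} (meets : MeetsRightAt S w) where

    private
      only-w : ∀ y → φ₂ y ∈ S → φ₂ y ≡ w
      only-w = proj₂ meets

    meetsAt-size : ∣ S ∣ ≡ ∣ S ∘ φ₁ ∣
    meetsAt-size = +-cancelʳ-≡ ∣ S ∩ pair u v ∣ _ _ (begin
      ∣ S ∣ + ∣ S ∩ pair u v ∣       ≡⟨ vertex-sum S ⟩
      ∣ S ∘ φ₁ ∣ + ∣ S ∘ φ₂ ∣        ≡⟨ cong (∣ S ∘ φ₁ ∣ +_) (∣∣-preimage φ₂ (φ₂-inj _ _) S) ⟩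
      ∣ S ∘ φ₁ ∣ + ∣ S ∩ image φ₂ ∣  ≡⟨ cong (∣ S ∘ φ₁ ∣ +_) (∣∣-cong S∩φ₂≗S∩pair) ⟩
      ∣ S ∘ φ₁ ∣ + ∣ S ∩ pair u v ∣  ∎)
      where
      open ≡-Reasoning
      S∩φ₂⊆S∩pair : S ∩ image φ₂ ⊆ S ∩ pair u v
      S∩φ₂⊆S∩pair z z∈ with ∧-true⁻ {S z} z∈
      ... | z∈S , z∈φ₂ with ∈image⁻ φ₂ z z∈φ₂
      ... | y , refl =
        cong₂ _∧_ z∈S (subst (_∈ pair u v) (sym (only-w y z∈S)) (∈pair⁺ u v (proj₁ meets)))
      pair⊆φ₂ : pair u v ⊆ image φ₂
      pair⊆φ₂ = pair⊆ u v (∈image⁺ φ₂ u∈φ₂) (∈image⁺ φ₂ v∈φ₂)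
      S∩φ₂≗S∩pair : S ∩ image φ₂ ≗ S ∩ pair u v
      S∩φ₂≗S∩pair = ⊆-antisym S∩φ₂⊆S∩pair λ z z∈ →
        let z∈S , z∈pair = ∧-true⁻ {S z} z∈ in cong₂ _∧_ z∈S (pair⊆φ₂ z z∈pair)

    meetsAt-edges : edges H S ≡ edges G₁ (S ∘ φ₁)
    meetsAt-edges = begin
      edges H S
        ≡⟨ +-identityʳ _ ⟨
      edges H S + 0
        ≡⟨ cong₂ (λ a b → edges H S + (𝟙 a + 𝟙 b)) e₁∉ (no-edge₂ e₂) ⟨
      edges H S + (𝟙 (inE G₁ (S ∘ φ₁) e₁) + 𝟙 (inE G₂ (S ∘ φ₂) e₂))
        ≡⟨ edge-sum S ⟩
      edges G₁ (S ∘ φ₁) + edges G₂ (S ∘ φ₂)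
        ≡⟨ cong (edges G₁ (S ∘ φ₁) +_) (all∉⇒∣S∣≡0 no-edge₂) ⟩
      edges G₁ (S ∘ φ₁) + 0
        ≡⟨ +-identityʳ _ ⟩
      edges G₁ (S ∘ φ₁)
        ∎
      where
      open ≡-Reasoning
      e₁∉ : e₁ ∉ inE G₁ (S ∘ φ₁)
      e₁∉ = ¬-not λ e₁∈ → let u∈S , v∈S = ∧-true⁻ e₁∈ in
        u≢v (meetsAt-unique {S} meets u∈φ₂ v∈φ₂ u∈S v∈S)
      no-edge₂ : ∀ g → g ∉ inE G₂ (S ∘ φ₂)
      no-edge₂ g = ¬-not λ g∈ → let a∈S , b∈S = ∧-true⁻ g∈ in
        proj₁ tc₂ g (φ₂-inj _ _ (trans (only-w _ a∈S) (sym (only-w _ b∈S))))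

    meetsAt-tight : Tight G₁ (S ∘ φ₁) ⇔ Tight H S
    meetsAt-tight = mk⇔
      (subst₂ (λ e s → e + 3 ≡ 2 * s) (sym meetsAt-edges) (sym meetsAt-size))
      (subst₂ (λ e s → e + 3 ≡ 2 * s) meetsAt-edges meetsAt-size)

  compatible-tight : EdgeCount G₂ → ∀ {S} → RightCompatible S → Tight G₁ (S ∘ φ₁) ⇔ Tight H S
  compatible-tight edge-count₂ {S} (inj₁ covers)      = covers-tight {S} covers edge-count₂
  compatible-tight edge-count₂ {S} (inj₂ (_ , meets)) = meetsAt-tight {S} meets

  good-restrict : ∀ {S} → RightCompatible S → Good H S → Good G₁ (S ∘ φ₁)
  good-restrict {S} compatible good = record
    { proper  = left-proper compatible
    ; inside  = record
      { nontrivial = left-nontrivial compatible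
      ; whole      = connected-left (_∈? S) (Biconnected.whole inside)
      ; minus      = λ x → connected-resp
          ((λ (x∈S , ≢x) → x∈S , ≢x ∘ cong φ₁) , (λ (x∈S , ≢x) → x∈S , ≢x ∘ φ₁-inj _ _))
          (connected-left (λ z → (z ∈? S) ×-dec ¬? (z Fin.≟ φ₁ x))
            (Biconnected.minus inside (φ₁ x))) }
    ; outside = connected-left (_∉? S) outside }
    where
    open Good good
    left-proper : RightCompatible S → ∃[ x ] φ₁ x ∉ S
    left-proper (inj₂ (_ , meets)) = [ u₁ ,_ , v₁ ,_ ]′ (meetsAt-excludes {S} meets)
    left-proper (inj₁ covers) with proper
    ... | z , z∉S with cover z
    ... | inj₁ (x , refl) = x , z∉S
    ... | inj₂ z∈φ₂       = ∈-∉-elim (covers⇒∈ {S} covers z∈φ₂) z∉S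
    left-nontrivial : RightCompatible S → Nontrivial (λ x → φ₁ x ∈ S)
    left-nontrivial (inj₁ covers) =
      u₁ , v₁ , proj₁ tc₁ e₁ , covers⇒∈ {S} covers u∈φ₂ , covers⇒∈ {S} covers v∈φ₂
    left-nontrivial (inj₂ (w , w-end , only-w)) with Biconnected.nontrivial inside
    ... | a , b , a≢b , a∈S , b∈S with ∈S⇒∈φ₁ a a∈S | ∈S⇒∈φ₁ b b∈S
      where
      w∈φ₁ : Image φ₁ w
      w∈φ₁ = [ (λ w≡u → u₁ , sym w≡u) , (λ w≡v → v₁ , sym w≡v) ]′ w-end
      ∈S⇒∈φ₁ : ∀ z → z ∈ S → Image φ₁ z
      ∈S⇒∈φ₁ z z∈S with cover z
      ... | inj₁ z∈φ₁       = z∈φ₁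
      ... | inj₂ (y , refl) = subst (Image φ₁) (sym (only-w y z∈S)) w∈φ₁
    ... | x , refl | y , refl = x , y , a≢b ∘ cong φ₁ , a∈S , b∈S

  good-extend : ∀ {S} → RightAttached (_∈ S) → (∀ a → RightAttached ((_∈ S) ∖ a)) →
    RightAttached (_∉ S) → Good G₁ (S ∘ φ₁) → Good H S
  good-extend {S} in-attached minus-attached out-attached good = record
    { proper  = let x , x∉S = proper in φ₁ x , x∉S
    ; inside  = record
      { nontrivial = let x , y , x≢y , x∈S , y∈S = nontrivial in
          φ₁ x , φ₁ y , x≢y ∘ φ₁-inj x y , x∈S , y∈S
      ; whole      = connected-glue whole in-attached
      ; minus      = λ a → connected-glue (left-minus a) (minus-attached a) }
    ; outside = connected-glue outside out-attached }
    where
    open Good good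
    open Biconnected inside
    left-minus : ∀ a → Connected (toGr G₁) (λ x → φ₁ x ∈ S × φ₁ x ≢ a)
    left-minus a with image? φ₁ a
    ... | yes (x , refl) = connected-resp
      ((λ (∈S , ≢x) → ∈S , ≢x ∘ φ₁-inj _ _) , (λ (∈S , ≢x) → ∈S , ≢x ∘ cong φ₁)) (minus x)
    ... | no a∉φ₁ = connected-resp ((λ ∈S → ∈S , λ eq → a∉φ₁ (_ , eq)) , proj₁) whole

  private
    extension : Subset (n G₁) → Subset (n H)
    extension S = extend S (S u₁ ∧ S v₁)

  extension-compatible : ∀ S → RightCompatible (extension S)
  extension-compatible S with ∈⊎∉ u₁ S | ∈⊎∉ v₁ S
  ... | inj₁ u∈S | inj₁ v∈S rewrite u∈S | v∈S =
    inj₁ λ y → extend-φ₂ S true y (λ _ → u∈S) (λ _ → v∈S)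
  ... | inj₂ u∉S | _ rewrite u∉S =
    inj₂ (v , inj₂ refl , λ y y∈ → decidable-stable (φ₂ y Fin.≟ v) λ y≢v →
      ∈-∉-elim y∈ (extend-φ₂ S false y (λ _ → u∉S) (λ y≡v → ⊥-elim (y≢v y≡v))))
  ... | inj₁ u∈S | inj₂ v∉S rewrite u∈S | v∉S =
    inj₂ (u , inj₁ refl , λ y y∈ → decidable-stable (φ₂ y Fin.≟ u) λ y≢u →
      ∈-∉-elim y∈ (extend-φ₂ S false y (λ y≡u → ⊥-elim (y≢u y≡u)) (λ _ → v∉S)))

  module _ (right : Biconnected (toGr H) (Image φ₂)) where

    open Biconnected right

    covers-good : ∀ {S} → CoversRight S → Good G₁ (S ∘ φ₁) → Good H S
    covers-good {S} covers = good-extend {S}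
      (record
        { right-connected = connected-resp ((λ z∈φ₂ → z∈φ₂ , ∈S z∈φ₂) , proj₁) whole
        ; anchor          = λ _ _ → inj₁ (∈S u∈φ₂) })
      (λ a → record
        { right-connected = connected-resp
            ((λ (z∈φ₂ , z≢a) → z∈φ₂ , ∈S z∈φ₂ , z≢a) , (λ (z∈φ₂ , _ , z≢a) → z∈φ₂ , z≢a)) (minus a)
        ; anchor          = λ _ _ → one-remains a })
      (record
        { right-connected = connected λ _ (z∈φ₂ , z∉S) _ → ∈-∉-elim (∈S z∈φ₂) z∉S
        ; anchor          = λ y y∉S → ∈-∉-elim (covers y) y∉S })
      where
      ∈S : ∀ {z} → Image φ₂ z → z ∈ S
      ∈S = covers⇒∈ {S} covers
      one-remains : ∀ a → (u ∈ S × u ≢ a) ⊎ (v ∈ S × v ≢ a)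
      one-remains a with u Fin.≟ a
      ... | yes refl = inj₂ (∈S v∈φ₂ , u≢v ∘ sym)
      ... | no u≢a   = inj₁ (∈S u∈φ₂ , u≢a)

    meetsAt-good : ∀ {S w} → MeetsRightAt S w → Good G₁ (S ∘ φ₁) → Good H S
    meetsAt-good {S} {w} meets@(w-end , only-w) = good-extend {S}
      (inside-attached id) (λ _ → inside-attached proj₁)
      (record { right-connected = right-outside ; anchor = λ _ _ → meetsAt-excludes {S} meets })
      where
      at-w : ∀ {z} → Image φ₂ z → z ∈ S → z ≡ w
      at-w (y , refl) = only-w y
      inside-attached : {P : Fin (n H) → Set} → (∀ {z} → P z → z ∈ S) → RightAttached P
      inside-attached {P} P⊆S = record
        { right-connected = connected-subsingleton w λ (z∈φ₂ , pz) → at-w z∈φ₂ (P⊆S pz)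
        ; anchor          = λ y py → let pw = subst P (only-w y (P⊆S py)) py in
            Sum.map (λ w≡u → subst P w≡u pw) (λ w≡v → subst P w≡v pw) w-end }
      right-outside : Connected (toGr H) (λ z → Image φ₂ z × z ∉ S)
      right-outside with ∈⊎∉ w S
      ... | inj₁ w∈S = connected-resp
        ( (λ (z∈φ₂ , z≢w) → z∈φ₂ , ¬-not (z≢w ∘ at-w z∈φ₂))
        , (λ (z∈φ₂ , z∉S) → z∈φ₂ , λ { refl → ∈-∉-elim w∈S z∉S })) (minus w)
      ... | inj₂ w∉S = connected-resp
        ( (λ z∈φ₂ → z∈φ₂ , ¬-not (λ z∈S → ∈-∉-elim (subst (_∈ S) (at-w z∈φ₂ z∈S) z∈S) w∉S))
        , proj₁) whole

    compatible-good : ∀ {S} → RightCompatible S → Good G₁ (S ∘ φ₁) → Good H S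
    compatible-good {S} (inj₁ covers)      = covers-good {S} covers
    compatible-good {S} (inj₂ (_ , meets)) = meetsAt-good {S} meets

    restrict-spade₂ : Spade₂ H → EdgeCount G₁ → EdgeCount G₂ → Spade₂ G₁
    restrict-spade₂ sp edge-count₁ edge-count₂ =
      record { edge-count = edge-count₁ ; tight = tight₁ }
      where
      tight₁ : ∀ S → Good G₁ S → Tight G₁ S
      tight₁ S good = tight-resp {G₁} S⁺≗S
        (Equivalence.from (compatible-tight edge-count₂ {S⁺} (extension-compatible S))
          (Spade₂.tight sp S⁺ S⁺-good))
        where
        S⁺ : Subset (n H)
        S⁺ = extension S
        S⁺≗S : S⁺ ∘ φ₁ ≗ S
        S⁺≗S = extend-φ₁ S (S u₁ ∧ S v₁)
        S⁺-good : Good H S⁺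
        S⁺-good = compatible-good {S⁺} (extension-compatible S) (good-resp (sym ∘ S⁺≗S) good)

  one-side : {P : Fin (n H) → Set} → (∀ {z} → P z → z ∉ pair u v) → Connected (toGr H) P →
    ∀ {x y} → P (φ₁ x) → P (φ₂ y) → ⊥
  one-side {P} avoids con {x} {y} px py =
    ∈-∉-elim (trans (sym (constant con lc px py)) (∈image⁺ φ₁ (x , refl))) (right-only py)
    where
    right-only : ∀ {y} → P (φ₂ y) → φ₂ y ∉ image φ₁
    right-only {y} py = ¬-not λ y∈φ₁ → let x , eq = ∈image⁻ φ₁ (φ₂ y) y∈φ₁ in
      ∈-∉-elim (∈pair⁺ u v (shared {x} {y} eq)) (avoids py)
    lc : LocallyConstant (toGr H) P (image φ₁)
    lc pa pb l with linkView l
    ... | on-left {x} {y} _ = trans (∈image⁺ φ₁ (x , refl)) (sym (∈image⁺ φ₁ (y , refl)))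
    ... | on-right _ _      = trans (right-only pa) (sym (right-only pb))

good⇒compatible : ∀ {G₁ G₂ H} (C : ConstrA 2 G₁ G₂ H) {S} → Good H S →
  RightCompatible C S ⊎ RightCompatible (constrA-sym C) S
good⇒compatible {G₁} {G₂} {H} C {S} good = by-trace (∈⊎∉ u S) (∈⊎∉ v S)
  where
  open Glued C
  open Good good

  both-inside : u ∈ S → v ∈ S → RightCompatible C S ⊎ RightCompatible (constrA-sym C) S
  both-inside u∈S v∈S with any? (λ y → φ₂ y ∉? S)
  ... | no none       = inj₁ (inj₁ λ y → ¬-not λ y∉S → none (y , y∉S))
  ... | yes (y , y∉S) = inj₂ (inj₁ λ x → ¬-not λ x∉S → one-side C avoids outside x∉S y∉S)
    where
    avoids : ∀ {z} → z ∉ S → z ∉ pair u v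
    avoids {z} z∉S = ¬-not λ z∈pair → ∈-∉-elim (pair⊆ u v u∈S v∈S z z∈pair) z∉S

  one-inside : ∀ {w} → w ≡ u ⊎ w ≡ v → (∀ {z} → z ∈ S × z ≢ w → z ∉ pair u v) →
    RightCompatible C S ⊎ RightCompatible (constrA-sym C) S
  one-inside {w} w-end avoids with any? (λ y → (φ₂ y ∈? S) ×-dec ¬? (φ₂ y Fin.≟ w))
  ... | no none = inj₁ (inj₂ (w , w-end , λ y y∈S →
    decidable-stable (φ₂ y Fin.≟ w) λ y≢w → none (y , y∈S , y≢w)))
  ... | yes (y , y∈S , y≢w) = inj₂ (inj₂ (w , uEq-ends glue w-end , λ x x∈S →
    decidable-stable (φ₁ x Fin.≟ w) λ x≢w →
      one-side C avoids (Biconnected.minus inside w) (x∈S , x≢w) (y∈S , y≢w)))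

  by-trace : u ∈ S ⊎ u ∉ S → v ∈ S ⊎ v ∉ S → RightCompatible C S ⊎ RightCompatible (constrA-sym C) S
  by-trace (inj₁ u∈S) (inj₁ v∈S) = both-inside u∈S v∈S
  by-trace (inj₁ u∈S) (inj₂ v∉S) = one-inside (inj₁ refl) λ (z∈S , z≢u) →
    ∉pair⁺ u v z≢u λ { refl → ∈-∉-elim z∈S v∉S }
  by-trace (inj₂ u∉S) _ = one-inside (inj₂ refl) λ (z∈S , z≢v) →
    ∉pair⁺ u v (λ { refl → ∈-∉-elim z∈S u∉S }) z≢v

glue-spade₂ : ∀ {G₁ G₂ H} → ConstrA 2 G₁ G₂ H → Spade₂ G₁ → Spade₂ G₂ → Spade₂ H
glue-spade₂ {G₁} {G₂} {H} C sp₁ sp₂ = record { edge-count = edge-count ; tight = tight }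
  where
  open Glued C
  open ≡-Reasoning

  edges-full : m H + 2 ≡ m G₁ + m G₂
  edges-full = begin
    m H + 2                            ≡⟨ cong (_+ 2) (∣full∣≡k (m H)) ⟨
    ∣ full {m H} ∣ + 2                 ≡⟨ edge-sum full ⟩
    ∣ full {m G₁} ∣ + ∣ full {m G₂} ∣  ≡⟨ cong₂ _+_ (∣full∣≡k (m G₁)) (∣full∣≡k (m G₂)) ⟩
    m G₁ + m G₂                        ∎

  vertices-full : n H + 2 ≡ n G₁ + n G₂
  vertices-full = begin
    n H + 2                            ≡⟨ cong₂ _+_ (∣full∣≡k (n H)) (∣pair∣≡2 u≢v) ⟨
    ∣ full {n H} ∣ + ∣ pair u v ∣      ≡⟨ vertex-sum full ⟩
    ∣ full {n G₁} ∣ + ∣ full {n G₂} ∣  ≡⟨ cong₂ _+_ (∣full∣≡k (n G₁)) (∣full∣≡k (n G₂)) ⟩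
    n G₁ + n G₂                        ∎

  edge-count : m H + 2 ≡ 2 * n H
  edge-count = +-cancelʳ-≡ 4 _ _ (begin
    m H + 2 + 4                  ≡⟨ cong (_+ 4) edges-full ⟩
    m G₁ + m G₂ + 4              ≡⟨ regroup (m G₁) (m G₂) ⟩
    m G₁ + 2 + (m G₂ + 2)        ≡⟨ cong₂ _+_ (Spade₂.edge-count sp₁) (Spade₂.edge-count sp₂) ⟩
    2 * n G₁ + 2 * n G₂          ≡⟨ *-distribˡ-+ 2 (n G₁) (n G₂) ⟨
    2 * (n G₁ + n G₂)            ≡⟨ cong (2 *_) vertices-full ⟨
    2 * (n H + 2)                ≡⟨ *-distribˡ-+ 2 (n H) 2 ⟩
    2 * n H + 4                  ∎)
    where
    regroup : ∀ a b → a + b + 4 ≡ a + 2 + (b + 2)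
    regroup = solve-∀

  tight : ∀ S → Good H S → Tight H S
  tight S good with good⇒compatible C {S} good
  ... | inj₁ compatible = Equivalence.to
    (compatible-tight C (Spade₂.edge-count sp₂) {S} compatible)
    (Spade₂.tight sp₁ (S ∘ φ₁) (good-restrict C {S} compatible good))
  ... | inj₂ compatible = Equivalence.to
    (compatible-tight (constrA-sym C) (Spade₂.edge-count sp₁) {S} compatible)
    (Spade₂.tight sp₂ (S ∘ φ₂) (good-restrict (constrA-sym C) {S} compatible good))

-- Splitting along a separating pair

module InducedPlusEdge (G : MGraph) (A : Subset (n G)) {u v : Fin (n G)} (u∈A : u ∈ A) (v∈A : v ∈ A)
  where

  φ : Fin ∣ A ∣ → Fin (n G)
  φ = element A

  edge : Fin (edges G A) → Fin (m G)
  edge = element (inE G A)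

  private
    edge-ends∈A : ∀ j → end₁ G (edge j) ∈ A × end₂ G (edge j) ∈ A
    edge-ends∈A j = ∧-true⁻ (element∈ (inE G A) j)

    index : Element A → Fin ∣ A ∣
    index = Inverse.from (enumerate A)

    φ-index : ∀ x → φ (index x) ≡ proj₁ x
    φ-index x = cong proj₁ (Inverse.strictlyInverseˡ (enumerate A) x)

  -- The edge `zero` is the new edge uv.
  plusEdge : MGraph
  plusEdge = record
    { n = ∣ A ∣ ; m = suc (edges G A)
    ; ends = λ { zero    → index (u , ≡true⇒T u∈A) , index (v , ≡true⇒T v∈A)
               ; (suc j) → let a∈A , b∈A = edge-ends∈A j in
                   index (_ , ≡true⇒T a∈A) , index (_ , ≡true⇒T b∈A) } }

  φ-new-edge : mapPair φ (endsG plusEdge zero) ≡ (u , v)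
  φ-new-edge = cong₂ _,_ (φ-index _) (φ-index _)

  φ-ends : ∀ j → mapPair φ (endsG plusEdge (suc j)) ≡ endsG G (edge j)
  φ-ends j = cong₂ _,_ (φ-index _) (φ-index _)

  plusEdge-loopless : LoopFree G → u ≢ v → LoopFree plusEdge
  plusEdge-loopless loopFree u≢v zero eq =
    u≢v (trans (sym (cong proj₁ φ-new-edge)) (trans (cong φ eq) (cong proj₂ φ-new-edge)))
  plusEdge-loopless loopFree u≢v (suc j) eq = loopFree (edge j)
    (trans (sym (cong proj₁ (φ-ends j))) (trans (cong φ eq) (cong proj₂ (φ-ends j))))

  plusEdge-edge-count : Tight G A → EdgeCount plusEdge
  plusEdge-edge-count = trans (sym (+-suc (edges G A) 2))

  link-plusEdge : ∀ {x y} → Link (induced G A) x y → Link (toGr plusEdge) (index x) (index y)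
  link-plusEdge = λ { (forth (e , a∈A , b∈A)) → old-edge e a∈A b∈A
                    ; (back (e , a∈A , b∈A))  → link-sym (old-edge e a∈A b∈A) }
    where
    old-edge : ∀ e (a∈A : T (A (end₁ G e))) (b∈A : T (A (end₂ G e))) →
      Link (toGr plusEdge) (index (_ , a∈A)) (index (_ , b∈A))
    old-edge e a∈A b∈A with ∈⇒Image (inE G A) {e} (cong₂ _∧_ (T⇒≡true a∈A) (T⇒≡true b∈A))
    ... | j , refl = subst₂ (Link (toGr plusEdge))
      (cong index (Element-≡ refl)) (cong index (Element-≡ refl)) (forth (suc j))

  connected-plusEdge : {P : Fin (n G) → Set} →
    Connected (toGr G) (λ x → x ∈ A × P x) → Connected (toGr plusEdge) (P ∘ φ)
  connected-plusEdge {P} con = connected-image index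
    (λ {x} px → subst P (sym (φ-index x)) px)
    (λ {i} pi → to i , pi , strictlyInverseʳ i)
    (λ _ _ l → inj₂ (link-plusEdge l)) (connected-induced⁺ con)
    where open Inverse (enumerate A) using (to; strictlyInverseʳ)

  plusEdge-twoConnected : LoopFree G → u ≢ v → Biconnected (toGr G) (_∈ A) →
    TwoConnected (toGr plusEdge)
  plusEdge-twoConnected loopFree u≢v bi = record
    { loopless    = plusEdge-loopless loopFree u≢v
    ; biconnected = record
      { nontrivial = _ , _ , plusEdge-loopless loopFree u≢v zero , tt , tt
      ; whole      = connected-plusEdge (connected-resp ((_, tt) , proj₁) whole)
      ; minus      = λ i → connected-resp
          ((λ ≢i → tt , ≢i ∘ cong φ) , (λ (_ , ≢i) → ≢i ∘ element-injective A))
          (connected-plusEdge {_≢ φ i} (minus (φ i))) } }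
    where open Biconnected bi

module Decomposition {G : MGraph} (tc : TwoConnected (toGr G)) (sp : Spade₂ G)
  {u v : Fin (n G)} (u≢v : u ≢ v) (D : Separation G full (pair u v)) where

  open TwoConnected tc using (loopless)
  open SeparatingPair tc sp u≢v
  open Sides D (λ _ _ → refl)

  module Side (D : Separation G full (pair u v)) where

    open InducedPlusEdge G (side D) {u} {v}
      (pair⊆side D u (∈pairˡ u v)) (pair⊆side D v (∈pairʳ u v)) public

    side-biconnected : Biconnected (toGr G) (_∈ side D)
    side-biconnected = Good.inside (side-good D)

    image-biconnected : Biconnected (toGr G) (Image φ)
    image-biconnected = biconnected-resp (∈⇒Image (side D) , Image⇒∈ (side D)) side-biconnected

    twoConnected : TwoConnected (toGr plusEdge)
    twoConnected = plusEdge-twoConnected loopless u≢v side-biconnected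

    edge-count : EdgeCount plusEdge
    edge-count = plusEdge-edge-count (Spade₂.tight sp (side D) (side-good D))

    smaller : n plusEdge < n G
    smaller = subst (∣ side D ∣ <_) (∣full∣≡k (n G)) (∣side∣<∣Q∣ D)

    3≤n : 3 ≤ n plusEdge
    3≤n = subst (_< ∣ side D ∣) (∣pair∣≡2 u≢v) (∣core∣<∣side∣ D (λ _ _ → refl))

  module 𝓛 = Side D
  module 𝓡 = Side (flip D)

  G₁ G₂ : MGraph
  G₁ = 𝓛.plusEdge
  G₂ = 𝓡.plusEdge

  private
    disjoint-edges : ∀ e → e ∈ inE G L → e ∉ inE G R
    disjoint-edges e e∈L = ¬-not λ e∈R → <⇒≱ (≤-reflexive (cong suc (non-adjacent D)))
      (x∈S⇒1≤∣S∣ {S = inE G (pair u v)} e (trans (sym (E[L]∩E[R]≗E[core] e)) (cong₂ _∧_ e∈L e∈R)))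

    OldEdge : Set
    OldEdge = Element {m G₁} (∁ ⁅ zero ⁆) ⊎ Element {m G₂} (∁ ⁅ zero ⁆)

    edge-of : OldEdge → Fin (m G)
    edge-of (inj₁ (suc j , _)) = 𝓛.edge j
    edge-of (inj₂ (suc j , _)) = 𝓡.edge j

    edge-of-surjective : ∀ h → Image edge-of h
    edge-of-surjective h with ∨-true⁻ {inE G L h} (E[L]∪E[R]≗E[Q] h)
    ... | inj₁ h∈L = let j , eq = ∈⇒Image (inE G L) h∈L in inj₁ (suc j , tt) , eq
    ... | inj₂ h∈R = let j , eq = ∈⇒Image (inE G R) h∈R in inj₂ (suc j , tt) , eq

    edge-of-injective : ∀ {a b} → edge-of a ≡ edge-of b → a ≡ b
    edge-of-injective {inj₁ (suc i , _)} {inj₁ (suc j , _)} eq =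
      cong inj₁ (Element-≡ (cong suc (element-injective (inE G L) eq)))
    edge-of-injective {inj₂ (suc i , _)} {inj₂ (suc j , _)} eq =
      cong inj₂ (Element-≡ (cong suc (element-injective (inE G R) eq)))
    edge-of-injective {inj₁ (suc i , _)} {inj₂ (suc j , _)} eq = ∈-∉-elim
      (element∈ (inE G R) j) (subst (_∉ inE G R) eq (disjoint-edges _ (element∈ (inE G L) i)))
    edge-of-injective {inj₂ (suc i , _)} {inj₁ (suc j , _)} eq = ∈-∉-elim
      (element∈ (inE G R) i) (subst (_∉ inE G R) (sym eq) (disjoint-edges _ (element∈ (inE G L) j)))

    OldEdge↔E : OldEdge ↔ Fin (m G)
    OldEdge↔E = mk↔ₛ′ edge-of (proj₁ ∘ edge-of-surjective) (proj₂ ∘ edge-of-surjective)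
      (λ a → edge-of-injective (proj₂ (edge-of-surjective (edge-of a))))

    common-vertex : ∀ x y → 𝓛.φ x ≡ 𝓡.φ y → x ≡ end₁ G₁ zero ⊎ x ≡ end₂ G₁ zero
    common-vertex x y eq = Sum.map
      (λ φx≡u → element-injective L (trans φx≡u (sym (cong proj₁ 𝓛.φ-new-edge))))
      (λ φx≡v → element-injective L (trans φx≡v (sym (cong proj₂ 𝓛.φ-new-edge))))
      (∈pair⁻ u v (trans (sym (L∩R≗core (𝓛.φ x)))
        (cong₂ _∧_ (element∈ L x) (subst (_∈ R) (sym eq) (element∈ R y)))))

    ≡⇒UEq : {A : Set} {p q : A × A} → p ≡ q → UEq p q
    ≡⇒UEq refl = inj₁ (refl , refl)

  constrA : ConstrA 2 G₁ G₂ G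
  constrA = record
    { tc₁ = twoConnected⇒twoConn (finite-toGr G₁) 𝓛.twoConnected
    ; tc₂ = twoConnected⇒twoConn (finite-toGr G₂) 𝓡.twoConnected
    ; e₁ = zero ; e₂ = zero
    ; w₁ = weightIs1 𝓛.twoConnected 𝓛.edge-count zero
    ; w₂ = weightIs1 𝓡.twoConnected 𝓡.edge-count zero
    ; φ₁ = 𝓛.φ ; φ₂ = 𝓡.φ
    ; φ₁-inj = λ _ _ → element-injective L ; φ₂-inj = λ _ _ → element-injective R
    ; cover = λ z → Sum.map (∈⇒Image L) (∈⇒Image R) (∨-true⁻ {L z} (L∪R≗Q z))
    ; glue = ≡⇒UEq (trans 𝓛.φ-new-edge (sym 𝓡.φ-new-edge))
    ; only-glue = common-vertex
    ; ψ = OldEdge↔E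
    ; ψ-ends₁ = λ { (suc j , _) → ≡⇒UEq (sym (𝓛.φ-ends j)) }
    ; ψ-ends₂ = λ { (suc j , _) → ≡⇒UEq (sym (𝓡.φ-ends j)) } }

  spade₂-left : Spade₂ G₁
  spade₂-left = restrict-spade₂ constrA 𝓡.image-biconnected sp 𝓛.edge-count 𝓡.edge-count

  spade₂-right : Spade₂ G₂
  spade₂-right =
    restrict-spade₂ (constrA-sym constrA) 𝓛.image-biconnected sp 𝓡.edge-count 𝓛.edge-count

separating-pair⊎inseparable : ∀ G →
  (∃[ u ] ∃[ v ] u ≢ v × Disconnection (toGr G) (_∉ pair u v)) ⊎
  (∀ u v → u ≢ v → Connected (toGr G) (_∉ pair u v))
separating-pair⊎inseparable G = ∃⊎∀ λ u → ∃⊎∀ λ v → decide u v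
  where
  decide : ∀ u v → (u ≢ v × Disconnection (toGr G) (_∉ pair u v)) ⊎
    (u ≢ v → Connected (toGr G) (_∉ pair u v))
  decide u v with u Fin.≟ v | connected⊎disconnection G (_∉? pair u v)
  ... | yes u≡v | _        = inj₂ λ u≢v → ⊥-elim (u≢v u≡v)
  ... | no u≢v  | inj₁ con = inj₂ λ _ → con
  ... | no u≢v  | inj₂ D   = inj₁ (u≢v , D)

spade₂⇒classA : ∀ {G} → TwoConnected (toGr G) → Spade₂ G → 3 ≤ n G → ClassA 2 G
spade₂⇒classA = rec (<-wellFounded _)
  where
  rec : ∀ {G} → Acc _<_ (n G) → TwoConnected (toGr G) → Spade₂ G → 3 ≤ n G → ClassA 2 G
  rec {G} (acc below) tc sp 3≤n with separating-pair⊎inseparable G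
  ... | inj₂ inseparable       = base (Inseparable.isK₄ tc sp 3≤n inseparable)
  ... | inj₁ (u , v , u≢v , D) = step
      (rec (below 𝓛.smaller) 𝓛.twoConnected spade₂-left 𝓛.3≤n)
      (rec (below 𝓡.smaller) 𝓡.twoConnected spade₂-right 𝓡.3≤n) constrA
    where open Decomposition tc sp u≢v (disconnection-resp ((refl ,_) , proj₂) D)

classA⇒spade₂ : ∀ {G} → ClassA 2 G → Spade₂ G
classA⇒spade₂ (base isK₄)    = K₄⇒spade₂ isK₄
classA⇒spade₂ (step c₁ c₂ C) = glue-spade₂ C (classA⇒spade₂ c₁) (classA⇒spade₂ c₂)

theorem2p25 : (G : MGraph) → TwoConn (toGr G) →
    (Spade 2 G ⇔ (IsC2 G ⊎ ClassA 2 G))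
theorem2p25 G twoConn = mk⇔ (forward ∘ spade⇒spade₂ tc)
    (spade₂⇒spade tc ∘ [ C₂⇒spade₂ , classA⇒spade₂ ]′)
  where
  tc : TwoConnected (toGr G)
  tc = twoConn⇒twoConnected twoConn
  forward : Spade₂ G → IsC2 G ⊎ ClassA 2 G
  forward sp with n G ℕ.≟ 2
  ... | yes n≡2 = inj₁ (spade₂⇒C₂ (TwoConnected.loopless tc) sp n≡2)
  ... | no n≢2  = inj₂ (spade₂⇒classA tc sp (≤∧≢⇒< (2≤n tc) (n≢2 ∘ sym)))
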